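{- Let $k$ be a positive integer and $0<\varepsilon<1/4$. Then every $\varepsilon$-intransitive tournament on $n\ge \varepsilon^{ -10^5 k}$ vertices contains the $k$-th power of a cycle of length at least $\varepsilon n/1500$.
   Context: A tournament is a complete graph in which every edge is given an orientation; write $x\to y$ if the edge is oriented from $x$ to $y$. Given an ordering $v_1,\dots,v_n$ of the vertices, an edge $v_iv_j$ is backward if it is oriented $v_j\to v_i$ with $i<j$. An $n$-vertex tournament is $\varepsilon$-intransitive if for every ordering of its vertices there are at least $\varepsilon n^2$ backward edges. The $k$-th power of a cycle of length $m$ is a sequence of distinct vertices $x_1,\dots,x_m$ such that $x_i\to x_{i+j}$ for all $i\in[m]$ and $1\le j\le k$, indices taken modulo $m$.
   Formalization: The parameter ε is taken to be a rational number with 0 < ε < 1/4 rather than an arbitrary real number. -}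

module Defs where

open import Data.Nat as ℕ using (ℕ; zero; suc)
open import Data.Bool using (Bool; true; false; not)
open import Data.Fin using (Fin; toℕ)
open import Data.Fin.Permutation using (Permutation′; _⟨$⟩ʳ_)
open import Data.List using (List; length; filter; cartesianProduct)
open import Data.List.Base using (allFin)
open import Data.Product using (_×_; _,_; ∃)
open import Data.Rational as ℚ using (ℚ; 0ℚ; 1ℚ; 1/_; _*_)
open import Data.Integer using (+_)
open import Data.Rational.Properties using (pos⇒nonZero)
open import Relation.Binary.PropositionalEquality using (_≡_; _≢_)
open import Relation.Nullary using (¬_)
open import Relation.Nullary.Decidable using (Dec; yes; no)
open import Function.Definitions using (Injective)
open import Data.Nat.Properties using () renaming (_<?_ to _<ℕ?_)
open import Data.Bool.Properties using () renaming (_≟_ to _≟B_)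

ℕtoℚ : ℕ → ℚ
ℕtoℚ n = (+ n) ℚ./ 1

record Tournament (n : ℕ) : Set where
  field
    arc         : Fin n → Fin n → Bool
    irreflexive : ∀ x → arc x x ≡ false
    oriented    : ∀ x y → x ≢ y → arc y x ≡ not (arc x y)
open Tournament public

-- Given an ordering v₁,…,vₙ (a permutation σ, v_i = σ i) of the vertices,
-- the number of backward edges: pairs i < j with v_j → v_i.
backwardCount : ∀ {n} → Tournament n → Permutation′ n → ℕ
backwardCount {n} T σ =
  length (filter (λ p → isBackward p ≟B true) (cartesianProduct (allFin n) (allFin n)))
  where
  isBackward : (Fin n × Fin n) → Bool
  isBackward (i , j) with toℕ i <ℕ? toℕ j
  ... | yes _ = arc T (σ ⟨$⟩ʳ j) (σ ⟨$⟩ʳ i)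
  ... | no  _ = false

Intransitive : ∀ {n} → ℚ → Tournament n → Set
Intransitive {n} ε T =
  ∀ (σ : Permutation′ n) →
    ε * (ℕtoℚ n * ℕtoℚ n) ℚ.≤ ℕtoℚ (backwardCount T σ)

-- The k-th power of a cycle of length m in T: distinct vertices x_0,…,x_{m-1}
-- with x_i → x_{i+d} for all i and 1 ≤ d ≤ k, indices modulo m.
-- "j ≡ i + d (mod m)" with j < m is expressed as ∃ q. i + d = j + q·m.
IsCyclePower : ∀ {n} → Tournament n → (k m : ℕ) → (Fin m → Fin n) → Set
IsCyclePower T k m x =
  Injective _≡_ _≡_ x ×
  (∀ (i j : Fin m) (d : ℕ) → 1 ℕ.≤ d → d ℕ.≤ k →
     ∃ (λ q → toℕ i ℕ.+ d ≡ toℕ j ℕ.+ q ℕ.* m) →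
     arc T (x i) (x j) ≡ true)

_^ℚ_ : ℚ → ℕ → ℚ
q ^ℚ zero  = 1ℚ
q ^ℚ suc m = q * (q ^ℚ m)

invPow : (ε : ℚ) → 0ℚ ℚ.< ε → ℕ → ℚ
invPow ε h m = ((1/ ε) {{pos⇒nonZero ε {{ℚ.positive h}}}}) ^ℚ m

{-# OPTIONS --safe #-}
module Submission where

-- Let E = ⌊1/ε⌋ + 1. Splitting the vertex set repeatedly along sparse cuts, and moving vertices of
-- small out-degree to the end of the order, would produce an order with few backward arcs. So
-- intransitivity yields a vertex set U all of whose cuts are dense, together with a subset K of U in
-- which every out-degree is at least n/2E.
-- In K, dependent random choice greedily builds a long chain of transitive blobs of size 2k, each
-- dominating the next. To close it up, let Y be the set of common in-neighbours of its first blob. By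
-- the density of cuts, the vertices with many out-neighbours in Y, then those with many
-- out-neighbours among these, and so on, soon exhaust U, so from the end of the chain one can descend
-- through these layers to Y by blobs of size k. The return path takes at most k vertices from each
-- blob of the chain; these are deleted from the chain, whose blobs keep at least k vertices.

-- Cut density alone gives out-degrees of order |U|/E, and |U| may be as small as order n/E, so a
-- chain built from that bound is only guaranteed length of order n/E². Measuring the out-degrees
-- inside K against n keeps the length linear in 1/E. The obstacle is the return path. The chain may
-- occupy a share of order 1/E of all vertices, and the arcs that density supplies between layers
-- may all run through it, so disjointness cannot be demanded. Instead the return crosses the chain
-- under one rule: a chain blob met by one return blob is forbidden to all later ones. So a chain
-- blob meets at most one return blob, which explains the sizes 2k and k. The rule is cheap: there
-- are at most about G³ return blobs, each forbidding at most k + 2k² vertices, while n is at least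
-- `G ^ 20`, where `G` is the loss factor of dependent random choice.

module CyclePowers where

  open import Defs
  open import Data.Bool using (Bool; true; false; not; _∧_; _∨_; if_then_else_)
  open import Data.Bool.ListAction using (all)
  import Data.Bool.Properties as Bool
  open import Data.Bool.Properties using (T?; T-≡; not-involutive)
  open import Data.Empty using (⊥)
  open import Data.Fin using (Fin; zero; suc; toℕ; cast)
  open import Data.Fin.Permutation using (Permutation′; permutation; _⟨$⟩ʳ_)
  import Data.Fin.Properties as Fin
  open import Data.Fin.Properties using (toℕ<n; toℕ-cast; cast-is-id; cast-trans)
  open import Data.Fin.Subset using (Subset)
  open import Data.Fin.Subset.Properties using (anySubset?)
  open import Data.Integer as ℤ using (ℤ)
  import Data.Integer.Properties as ℤ
  open import Data.List using
    (List; []; _∷_; _++_; length; filterᵇ; filter; map; take; [_]; concat; concatMap; cartesianProduct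
    ; cartesianProductWith; allFin; lookup)
  open import Data.List.Membership.Propositional using (_∈_; _∉_; find; lose)
  open import Data.List.Membership.Propositional.Properties using
    (∈-filter⁺; ∈-filter⁻; ∈-cartesianProductWith⁺; ∈-++⁻; ∈-++⁺ˡ; ∈-++⁺ʳ; ∈-∃++; ∈-allFin; ∈-lookup
    ; ∈-concat⁺′; ∈-concatMap⁺)
  import Data.List.Membership.DecPropositional as DecMembership
  open import Data.List.Properties using
    (length-++; length-map; length-take; length-tabulate; map-tabulate; filter-++; concat-++; ++-assoc
    ; ++-identityʳ)
  open import Data.List.Relation.Binary.Permutation.Propositional as Perm using (_↭_; ↭-sym; ↭-trans; prep; ↭⇒↭ₛ)
  import Data.List.Relation.Binary.Permutation.Propositional.Properties as Perm
  import Data.List.Relation.Binary.Permutation.Setoid.Properties as PermSetoid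
  open import Data.List.Relation.Binary.Pointwise as Pointwise using (Pointwise; []; _∷_)
  open import Data.List.Relation.Binary.Subset.Propositional using (_⊆_)
  open import Data.List.Relation.Unary.All as All using (All; []; _∷_)
  import Data.List.Relation.Unary.All.Properties as All
  open import Data.List.Relation.Unary.AllPairs as AllPairs using (AllPairs; []; _∷_)
  import Data.List.Relation.Unary.AllPairs.Properties as AllPairs
  open import Data.List.Relation.Unary.Any as Any using (here; there)
  open import Data.List.Relation.Unary.Any.Properties using (lookup-index)
  open import Data.List.Relation.Unary.Linked using (Linked; []; [-]; _∷_)
  open import Data.List.Relation.Unary.Unique.Propositional using (Unique)
  import Data.List.Relation.Unary.Unique.Propositional.Properties as Unique
  open import Data.Nat
  open import Data.Nat.Coprimality as Coprimality using (Coprime; 1-coprimeTo)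
  open import Data.Nat.DivMod using (m/n*n≤m; m≡m%n+[m/n]*n; m%n<n; /-monoˡ-≤; m*n/n≡m)
  open import Data.Nat.Properties
  open import Data.Nat.Tactic.RingSolver using (solve-∀)
  open import Data.Product using (_×_; _,_; ∃; proj₁; proj₂)
  open import Data.Rational as ℚ using (ℚ; mkℚ; toℚᵘ; *≤*; *<*)
  import Data.Rational.Properties as ℚ
  open import Data.Rational.Unnormalised as ℚᵘ using (mkℚᵘ)
  import Data.Rational.Unnormalised.Properties as ℚᵘ
  open import Data.Sum using (_⊎_; inj₁; inj₂; [_,_]′)
  open import Data.Unit using (⊤; tt)
  import Data.Vec as Vec
  open import Data.Vec.Properties using (lookup∘tabulate)
  open import Function using (_∘_; Equivalence)
  open import Function.Definitions using (Injective)
  open import Relation.Binary.PropositionalEquality hiding ([_])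
  open import Relation.Nullary using (¬_; Dec; yes; no; does; contradiction)
  open import Relation.Nullary.Decidable using (_×-dec_; dec-true; dec-false)

  private variable A B C Q : Set

  -- Finite sums and counting over lists

  sumOf : List A → (A → ℕ) → ℕ
  sumOf []       f = 0
  sumOf (x ∷ xs) f = f x + sumOf xs f

  𝟙 : Bool → ℕ
  𝟙 true  = 1
  𝟙 false = 0

  count : (A → Bool) → List A → ℕ
  count p xs = sumOf xs (𝟙 ∘ p)

  𝟙≤1 : ∀ b → 𝟙 b ≤ 1
  𝟙≤1 true  = ≤-refl
  𝟙≤1 false = z≤n

  𝟙-∧ : ∀ a b → 𝟙 (a ∧ b) ≡ 𝟙 a * 𝟙 b
  𝟙-∧ true  b = sym (+-identityʳ _)
  𝟙-∧ false b = refl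

  𝟙-mono : ∀ {a b} → (a ≡ true → b ≡ true) → 𝟙 a ≤ 𝟙 b
  𝟙-mono {true}  h = ≤-reflexive (cong 𝟙 (sym (h refl)))
  𝟙-mono {false} h = z≤n

  ∧-intro : ∀ {a b} → a ≡ true → b ≡ true → a ∧ b ≡ true
  ∧-intro refl refl = refl

  ∧-elimˡ : ∀ {a b} → a ∧ b ≡ true → a ≡ true
  ∧-elimˡ {true} _ = refl

  ∧-elimʳ : ∀ {a b} → a ∧ b ≡ true → b ≡ true
  ∧-elimʳ {true} h = h

  sum-mono : ∀ (xs : List A) {f g} → (∀ {x} → x ∈ xs → f x ≤ g x) → sumOf xs f ≤ sumOf xs g
  sum-mono []       h = z≤n
  sum-mono (x ∷ xs) h = +-mono-≤ (h (here refl)) (sum-mono xs (h ∘ there))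

  sum-cong : ∀ (xs : List A) {f g} → (∀ x → f x ≡ g x) → sumOf xs f ≡ sumOf xs g
  sum-cong []       h = refl
  sum-cong (x ∷ xs) h = cong₂ _+_ (h x) (sum-cong xs h)

  +-interchange : ∀ a b c d → (a + b) + (c + d) ≡ (a + c) + (b + d)
  +-interchange = solve-∀

  sum-+ : ∀ (xs : List A) f g → sumOf xs (λ x → f x + g x) ≡ sumOf xs f + sumOf xs g
  sum-+ []       f g = refl
  sum-+ (x ∷ xs) f g = trans (cong (f x + g x +_) (sum-+ xs f g)) (+-interchange (f x) (g x) _ _)

  sum-*ˡ : ∀ c (xs : List A) f → sumOf xs (λ x → c * f x) ≡ c * sumOf xs f
  sum-*ˡ c []       f = sym (*-zeroʳ c)
  sum-*ˡ c (x ∷ xs) f = trans (cong (c * f x +_) (sum-*ˡ c xs f)) (sym (*-distribˡ-+ c (f x) _))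

  sum-*ʳ : ∀ c (xs : List A) f → sumOf xs (λ x → f x * c) ≡ sumOf xs f * c
  sum-*ʳ c []       f = refl
  sum-*ʳ c (x ∷ xs) f = trans (cong (f x * c +_) (sum-*ʳ c xs f)) (sym (*-distribʳ-+ c (f x) _))

  sum-const : ∀ (xs : List A) c → sumOf xs (λ _ → c) ≡ length xs * c
  sum-const []       c = refl
  sum-const (x ∷ xs) c = cong (c +_) (sum-const xs c)

  sum-swap : ∀ (xs : List A) (ys : List B) (f : A → B → ℕ) →
             sumOf xs (λ x → sumOf ys (f x)) ≡ sumOf ys (λ y → sumOf xs (λ x → f x y))
  sum-swap []       ys f = sym (trans (sum-const ys 0) (*-zeroʳ (length ys)))
  sum-swap (x ∷ xs) ys f = trans (cong (sumOf ys (f x) +_) (sum-swap xs ys f)) (sym (sum-+ ys (f x) _))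

  sum-++ : ∀ (xs ys : List A) f → sumOf (xs ++ ys) f ≡ sumOf xs f + sumOf ys f
  sum-++ []       ys f = refl
  sum-++ (x ∷ xs) ys f = trans (cong (f x +_) (sum-++ xs ys f)) (sym (+-assoc (f x) _ _))

  sum-map : ∀ (g : A → B) xs f → sumOf (map g xs) f ≡ sumOf xs (f ∘ g)
  sum-map g []       f = refl
  sum-map g (x ∷ xs) f = cong (f (g x) +_) (sum-map g xs f)

  sum-cartesianProduct : ∀ (xs : List A) (ys : List B) f →
                         sumOf (cartesianProduct xs ys) f ≡ sumOf xs (λ x → sumOf ys (λ y → f (x , y)))
  sum-cartesianProduct []       ys f = refl
  sum-cartesianProduct (x ∷ xs) ys f =
    trans (sum-++ (map (x ,_) ys) _ f) (cong₂ _+_ (sum-map (x ,_) ys f) (sum-cartesianProduct xs ys f))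

  sum-filter : ∀ p (xs : List A) f → sumOf (filterᵇ p xs) f ≡ sumOf xs (λ x → 𝟙 (p x) * f x)
  sum-filter p []       f = refl
  sum-filter p (x ∷ xs) f with p x
  ... | true  = cong₂ _+_ (sym (+-identityʳ (f x))) (sum-filter p xs f)
  ... | false = sum-filter p xs f

  sum-↭ : ∀ {xs ys : List A} f → xs ↭ ys → sumOf xs f ≡ sumOf ys f
  sum-↭ f Perm.refl            = refl
  sum-↭ f (Perm.prep x p)      = cong (f x +_) (sum-↭ f p)
  sum-↭ f (Perm.swap {xs} {ys} x y p) = begin
    f x + (f y + sumOf xs f) ≡⟨ sym (+-assoc (f x) _ _) ⟩
    f x + f y + sumOf xs f   ≡⟨ cong₂ _+_ (+-comm (f x) _) (sum-↭ f p) ⟩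
    f y + f x + sumOf ys f   ≡⟨ +-assoc (f y) _ _ ⟩
    f y + (f x + sumOf ys f) ∎
    where open ≡-Reasoning
  sum-↭ f (Perm.trans p q)     = trans (sum-↭ f p) (sum-↭ f q)

  -- This is the expectation argument in deterministic form: an inequality between averages holds at
  -- some point.
  sum-pigeonhole : ∀ (xs : List A) f g → 1 ≤ length xs → sumOf xs f ≤ sumOf xs g →
                   ∃ λ x → x ∈ xs × f x ≤ g x
  sum-pigeonhole (x ∷ xs) f g _ le with f x ≤? g x
  ... | yes fx≤gx = x , here refl , fx≤gx
  sum-pigeonhole (x ∷ []) f g _ le | no fx≰gx =
    contradiction (subst₂ _≤_ (+-identityʳ _) (+-identityʳ _) le) fx≰gx
  sum-pigeonhole (x ∷ xs@(_ ∷ _)) f g _ le | no fx≰gx =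
    let y , y∈ , q = sum-pigeonhole xs f g (s≤s z≤n) (≮⇒≥ λ lt → <⇒≱ (+-mono-< (≰⇒> fx≰gx) lt) le)
    in y , there y∈ , q

  length-filterᵇ : ∀ p (xs : List A) → length (filterᵇ p xs) ≡ count p xs
  length-filterᵇ p []       = refl
  length-filterᵇ p (x ∷ xs) with p x
  ... | true  = cong suc (length-filterᵇ p xs)
  ... | false = length-filterᵇ p xs

  count-filter : ∀ p q (xs : List A) → count q (filterᵇ p xs) ≡ count (λ x → p x ∧ q x) xs
  count-filter p q xs = trans (sum-filter p xs _) (sum-cong xs λ x → sym (𝟙-∧ (p x) (q x)))

  count-mono : ∀ {p q} (xs : List A) → (∀ {x} → x ∈ xs → p x ≡ true → q x ≡ true) → count p xs ≤ count q xs
  count-mono xs h = sum-mono xs λ x∈ → 𝟙-mono (h x∈)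

  count-cong : ∀ {p q} (xs : List A) → (∀ x → p x ≡ q x) → count p xs ≡ count q xs
  count-cong xs h = sum-cong xs (cong 𝟙 ∘ h)

  count≤length : ∀ p (xs : List A) → count p xs ≤ length xs
  count≤length p xs = ≤-trans (sum-mono xs λ _ → 𝟙≤1 _) (≤-reflexive (trans (sum-const xs 1) (*-identityʳ _)))

  count-∧-not : ∀ (p q : A → Bool) (xs : List A) → count p xs ≡ count (λ x → p x ∧ q x) xs + count (λ x → p x ∧ not (q x)) xs
  count-∧-not p q xs = trans (sum-cong xs λ x → 𝟙-split (p x) (q x)) (sum-+ xs _ _)
    where
    𝟙-split : ∀ a b → 𝟙 a ≡ 𝟙 (a ∧ b) + 𝟙 (a ∧ not b)
    𝟙-split true  true  = refl
    𝟙-split true  false = refl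
    𝟙-split false b     = refl

  count-not : ∀ (p : A → Bool) (xs : List A) → length xs ≡ count p xs + count (not ∘ p) xs
  count-not p xs = trans (sym (trans (sum-const xs 1) (*-identityʳ _))) (count-∧-not (λ _ → true) p xs)

  ∈-filterᵇ⁺ : ∀ p {x : A} {xs} → x ∈ xs → p x ≡ true → x ∈ filterᵇ p xs
  ∈-filterᵇ⁺ p x∈ px = ∈-filter⁺ (T? ∘ p) x∈ (Equivalence.from T-≡ px)

  ∈-filterᵇ⁻ : ∀ p {x : A} {xs} → x ∈ filterᵇ p xs → x ∈ xs × p x ≡ true
  ∈-filterᵇ⁻ p {xs = xs} x∈ =
    let y∈ , t = ∈-filter⁻ (T? ∘ p) {xs = xs} x∈ in y∈ , Equivalence.to T-≡ t

  length≥1⇒∈ : ∀ {xs : List A} → 1 ≤ length xs → ∃ λ x → x ∈ xs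
  length≥1⇒∈ {xs = x ∷ _} _ = x , here refl

  ∈⇒count≥1 : ∀ p {x : A} {xs} → x ∈ xs → p x ≡ true → 1 ≤ count p xs
  ∈⇒count≥1 p {xs = _ ∷ xs} (here refl) px rewrite px = s≤s z≤n
  ∈⇒count≥1 p {xs = y ∷ xs} (there x∈)  px = ≤-trans (∈⇒count≥1 p x∈ px) (m≤n+m _ (𝟙 (p y)))

  all-intro : ∀ (p : A → Bool) xs → (∀ {x} → x ∈ xs → p x ≡ true) → all p xs ≡ true
  all-intro p []       h = refl
  all-intro p (x ∷ xs) h = ∧-intro (h (here refl)) (all-intro p xs (h ∘ there))

  all-elim : ∀ (p : A → Bool) xs {x} → all p xs ≡ true → x ∈ xs → p x ≡ true
  all-elim p (x ∷ xs) h (here refl) = ∧-elimˡ h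
  all-elim p (x ∷ xs) h (there x∈)  = all-elim p xs (∧-elimʳ {p x} h) x∈

  listsOfLength : ℕ → List A → List (List A)
  listsOfLength zero    xs = [ [] ]
  listsOfLength (suc s) xs = cartesianProductWith _∷_ xs (listsOfLength s xs)

  length-cartesianProductWith : ∀ (f : A → B → C) xs ys →
    length (cartesianProductWith f xs ys) ≡ length xs * length ys
  length-cartesianProductWith f []       ys = refl
  length-cartesianProductWith f (x ∷ xs) ys = trans (length-++ (map (f x) ys))
    (cong₂ _+_ (length-map (f x) ys) (length-cartesianProductWith f xs ys))

  length-listsOfLength : ∀ s (xs : List A) → length (listsOfLength s xs) ≡ length xs ^ s
  length-listsOfLength zero    xs = refl
  length-listsOfLength (suc s) xs = trans (length-cartesianProductWith _∷_ xs (listsOfLength s xs))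
    (cong (length xs *_) (length-listsOfLength s xs))

  ∈-listsOfLength : ∀ (S : List A) {xs} → S ⊆ xs → S ∈ listsOfLength (length S) xs
  ∈-listsOfLength []      S⊆ = here refl
  ∈-listsOfLength (x ∷ S) S⊆ = ∈-cartesianProductWith⁺ _∷_ (S⊆ (here refl)) (∈-listsOfLength S (S⊆ ∘ there))

  take-⊆ : ∀ a (xs : List A) → take a xs ⊆ xs
  take-⊆ (suc a) (x ∷ xs) (here refl) = here refl
  take-⊆ (suc a) (x ∷ xs) (there y∈)  = there (take-⊆ a xs y∈)

  -- Dependent random choice by averaging

  module Selection (r : A → Q → Bool) (u : C → Q → Bool) (B : List Q) (D M W V : ℕ)
    {{_ : NonZero D}} {{_ : NonZero M}} (B≥1 : 1 ≤ length B) where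

    -- Restricting to one element b of B at a time, the potential |X|/Dᵗ − W|Y|/Mᵗ − V
    -- can be kept nonnegative, since its average over b does not decrease.
    select : ∀ t (X : List A) (Y : List C) →
      (∀ {x} → x ∈ X → length B ≤ D * count (r x) B) →
      (∀ {y} → y ∈ Y → M * count (u y) B ≤ length B) →
      W * length Y * D ^ t + V * (D * M) ^ t ≤ length X * M ^ t →
      ∃ λ bs → W * count (λ y → all (u y) bs) Y + V ≤ count (λ x → all (r x) bs) X
    select zero X Y degX degY le = [] , (begin
      W * count (λ _ → true) Y + V      ≡⟨ cong (λ z → W * z + V) (count-true Y) ⟩
      W * length Y + V                  ≡⟨ cong₂ _+_ (sym (*-identityʳ (W * length Y))) (sym (*-identityʳ V)) ⟩
      W * length Y * 1 + V * 1          ≤⟨ le ⟩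
      length X * 1                      ≡⟨ *-identityʳ (length X) ⟩
      length X                          ≡⟨ sym (count-true X) ⟩
      count (λ _ → true) X ∎)
      where
      open ≤-Reasoning
      count-true : ∀ {A : Set} (xs : List A) → count (λ _ → true) xs ≡ length xs
      count-true xs = trans (sum-const xs 1) (*-identityʳ _)
    select (suc t) X Y degX degY le =
      let b , _ , step = sum-pigeonhole B f g B≥1 averaged
          bs , fin = select t (filterᵇ (λ x → r x b) X) (filterᵇ (λ y → u y b) Y)
            (degX ∘ proj₁ ∘ ∈-filterᵇ⁻ (λ x → r x b))
            (degY ∘ proj₁ ∘ ∈-filterᵇ⁻ (λ y → u y b))
            (subst₂ (λ y x → W * y * D ^ t + V * (D * M) ^ t ≤ x * M ^ t)
              (sym (length-filterᵇ (λ y → u y b) Y)) (sym (length-filterᵇ (λ x → r x b) X)) step)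
      in b ∷ bs , subst₂ (λ y x → W * y + V ≤ x)
           (count-filter (λ y → u y b) (λ y → all (u y) bs) Y)
           (count-filter (λ x → r x b) (λ x → all (r x) bs) X) fin
      where
      open ≤-Reasoning
      f g : Q → ℕ
      f b = W * count (λ y → u y b) Y * D ^ t + V * (D * M) ^ t
      g b = count (λ x → r x b) X * M ^ t
      β = length B
      ΣX = sumOf B (λ b → count (λ x → r x b) X)
      ΣY = sumOf B (λ b → count (λ y → u y b) Y)
      ΣX≥ : length X * β ≤ D * ΣX
      ΣX≥ = begin
        length X * β                           ≡⟨ sym (sum-const X β) ⟩
        sumOf X (λ _ → β)                      ≤⟨ sum-mono X degX ⟩
        sumOf X (λ x → D * count (r x) B)      ≡⟨ sum-*ˡ D X _ ⟩
        D * sumOf X (λ x → count (r x) B)      ≡⟨ cong (D *_) (sum-swap X B λ x b → 𝟙 (r x b)) ⟩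
        D * ΣX ∎
      ΣY≤ : M * ΣY ≤ length Y * β
      ΣY≤ = begin
        M * ΣY                                 ≡⟨ cong (M *_) (sym (sum-swap Y B λ y b → 𝟙 (u y b))) ⟩
        M * sumOf Y (λ y → count (u y) B)      ≡⟨ sym (sum-*ˡ M Y _) ⟩
        sumOf Y (λ y → M * count (u y) B)      ≤⟨ sum-mono Y degY ⟩
        sumOf Y (λ _ → β)                      ≡⟨ sum-const Y β ⟩
        length Y * β ∎
      Σf : sumOf B f ≡ W * ΣY * D ^ t + β * (V * (D * M) ^ t)
      Σf = trans (sum-+ B _ _) (cong₂ _+_
        (trans (sum-*ʳ (D ^ t) B _) (cong (_* D ^ t) (sum-*ˡ W B _))) (sum-const B _))
      instance DM≢0 = m*n≢0 D M
      averaged : sumOf B f ≤ sumOf B g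
      averaged = *-cancelˡ-≤ (D * M) (begin
        D * M * sumOf B f                                         ≡⟨ cong (D * M *_) Σf ⟩
        D * M * (W * ΣY * D ^ t + β * (V * (D * M) ^ t))          ≡⟨ eq₁ D M W ΣY (D ^ t) β V ((D * M) ^ t) ⟩
        W * D ^ suc t * (M * ΣY) + β * (V * (D * M) ^ suc t)      ≤⟨ +-monoˡ-≤ _ (*-monoʳ-≤ (W * D ^ suc t) ΣY≤) ⟩
        W * D ^ suc t * (length Y * β) + β * (V * (D * M) ^ suc t) ≡⟨ eq₂ W (D ^ suc t) (length Y) β _ ⟩
        β * (W * length Y * D ^ suc t + V * (D * M) ^ suc t)      ≤⟨ *-monoʳ-≤ β le ⟩
        β * (length X * M ^ suc t)                                ≡⟨ eq₃ β (length X) _ ⟩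
        (length X * β) * M ^ suc t                                ≤⟨ *-monoˡ-≤ (M ^ suc t) ΣX≥ ⟩
        D * ΣX * (M * M ^ t)                                      ≡⟨ eq₄ D ΣX M (M ^ t) ⟩
        D * M * (ΣX * M ^ t)                                      ≡⟨ cong (D * M *_) (sym (sum-*ʳ (M ^ t) B _)) ⟩
        D * M * sumOf B g ∎)
        where
        eq₁ : ∀ D M W S p β V q → D * M * (W * S * p + β * (V * q)) ≡ W * (D * p) * (M * S) + β * (V * (D * M * q))
        eq₁ = solve-∀
        eq₂ : ∀ W p y β z → W * p * (y * β) + β * z ≡ β * (W * y * p + z)
        eq₂ = solve-∀
        eq₃ : ∀ β x p → β * (x * p) ≡ (x * β) * p
        eq₃ = solve-∀
        eq₄ : ∀ D S M p → D * S * (M * p) ≡ D * M * (S * p)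
        eq₄ = solve-∀

  -- The initial potential for `s` samples, with `a = D ^ (2 * s + 1)` candidates and at most
  -- `a ^ s` bad tuples. The exponent of `M = D ^ (2 * s + 4)` is large enough that (2s+1)(s+1) ≤
  -- (2s+4)s, which pays for the bad tuples; the exponent of `a` leaves a factor `D ^ suc s` to
  -- cover 1 + 2^s.
  potential-bound : ∀ {D s} → 4 ≤ D → 1 ≤ s →
    D ^ (2 * s + 1) * (D ^ (2 * s + 1)) ^ s * D ^ s + 2 ^ s * (D * D ^ (2 * s + 4)) ^ s ≤
    D ^ (2 * s + 1) * (D ^ (2 * s + 4)) ^ s
  potential-bound {D} {s} 4≤D 1≤s = begin
      a * a ^ s * D ^ s + 2 ^ s * (D * M) ^ s
        ≤⟨ +-mono-≤ (*-monoˡ-≤ (D ^ s) a^suc-s≤M^s)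
                    (≤-reflexive (cong (2 ^ s *_) (^-distribʳ-* s D M))) ⟩
      M ^ s * D ^ s + 2 ^ s * (D ^ s * M ^ s)   ≡⟨ eq (M ^ s) (D ^ s) (2 ^ s) ⟩
      (1 + 2 ^ s) * (D ^ s * M ^ s)             ≤⟨ *-monoˡ-≤ (D ^ s * M ^ s) 1+2^s≤ ⟩
      D ^ suc s * (D ^ s * M ^ s)               ≡⟨ sym (*-assoc (D ^ suc s) (D ^ s) (M ^ s)) ⟩
      D ^ suc s * D ^ s * M ^ s                 ≡⟨ cong (_* M ^ s) (sym (^-distribˡ-+-* D (suc s) s)) ⟩
      D ^ (suc s + s) * M ^ s                   ≡⟨ cong (λ e → D ^ e * M ^ s) (eq′ s) ⟩
      a * M ^ s ∎
      where
      open ≤-Reasoning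
      instance
        D≢0 : NonZero D
        D≢0 = >-nonZero (≤-trans (s≤s z≤n) 4≤D)
      M = D ^ (2 * s + 4)
      a = D ^ (2 * s + 1)
      eq : ∀ m d v → m * d + v * (d * m) ≡ (1 + v) * (d * m)
      eq = solve-∀
      eq′ : ∀ s → suc s + s ≡ 2 * s + 1
      eq′ = solve-∀
      ^-distribʳ-* : ∀ s x y → (x * y) ^ s ≡ x ^ s * y ^ s
      ^-distribʳ-* zero    x y = refl
      ^-distribʳ-* (suc s) x y = trans (cong (x * y *_) (^-distribʳ-* s x y)) ([m*n]*[o*p]≡[m*o]*[n*p] x y (x ^ s) (y ^ s))
      eqₗ : ∀ s → (2 * s + 1) * suc s ≡ 2 * s * s + 3 * s + 1
      eqₗ = solve-∀
      eqᵣ : ∀ s → 2 * s * s + 3 * s + s ≡ (2 * s + 4) * s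
      eqᵣ = solve-∀
      exponents : (2 * s + 1) * suc s ≤ (2 * s + 4) * s
      exponents = begin
        (2 * s + 1) * suc s       ≡⟨ eqₗ s ⟩
        2 * s * s + 3 * s + 1     ≤⟨ +-monoʳ-≤ (2 * s * s + 3 * s) 1≤s ⟩
        2 * s * s + 3 * s + s     ≡⟨ eqᵣ s ⟩
        (2 * s + 4) * s ∎
      a^suc-s≤M^s : a * a ^ s ≤ M ^ s
      a^suc-s≤M^s = begin
        a * a ^ s                       ≡⟨ ^-*-assoc D (2 * s + 1) (suc s) ⟩
        D ^ ((2 * s + 1) * suc s)       ≤⟨ ^-monoʳ-≤ D exponents ⟩
        D ^ ((2 * s + 4) * s)           ≡⟨ sym (^-*-assoc D (2 * s + 4) s) ⟩
        M ^ s ∎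
      1+2^s≤ : 1 + 2 ^ s ≤ D ^ suc s
      1+2^s≤ = begin
        1 + 2 ^ s       ≤⟨ +-monoˡ-≤ (2 ^ s) (m^n>0 2 s) ⟩
        2 ^ s + 2 ^ s   ≡⟨ cong (2 ^ s +_) (sym (+-identityʳ (2 ^ s))) ⟩
        2 ^ suc s       ≤⟨ ^-monoˡ-≤ (suc s) (≤-trans (s≤s (s≤s z≤n)) 4≤D) ⟩
        D ^ suc s ∎

  module TournamentLists {n : ℕ} (𝒯 : Tournament n) where

    V : Set
    V = Fin n

    _⟶_ : V → V → Set
    x ⟶ y = arc 𝒯 x y ≡ true

    ⟶⇒≢ : ∀ {x y} → x ⟶ y → x ≢ y
    ⟶⇒≢ {x} a refl with () ← trans (sym a) (irreflexive 𝒯 x)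

    Transitive : List V → Set
    Transitive = AllPairs _⟶_

    transitive⇒unique : ∀ {S} → Transitive S → Unique S
    transitive⇒unique = AllPairs.map ⟶⇒≢

    -- Of the at least 2^(s+1) - 1 vertices other than `x`, at least 2^s are all out-neighbours or
    -- all in-neighbours. In the first case `x` is put in front of the transitive list found among
    -- them, in the second case behind it.
    ramsey : ∀ s {xs} → Unique xs → 2 ^ s ≤ length xs →
             ∃ λ S → length S ≡ s × Transitive S × S ⊆ xs
    ramsey zero    u le = [] , refl , [] , λ ()
    ramsey (suc s) {[]} u le = contradiction (≤-trans (m^n>0 2 (suc s)) le) λ ()
    ramsey (suc s) {x ∷ xs} (x∉ ∷ u) le with 2 ^ s ≤? count (arc 𝒯 x) xs
    ... | yes big =
      let S , |S| , tr , S⊆ = ramsey s (Unique.filter⁺ (T? ∘ arc 𝒯 x) u)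
                                (≤-trans big (≤-reflexive (sym (length-filterᵇ (arc 𝒯 x) xs))))
      in x ∷ S , cong suc |S| , All.tabulate (λ y∈ → proj₂ (∈-filterᵇ⁻ _ {xs = xs} (S⊆ y∈))) ∷ tr ,
         λ { (here refl) → here refl ; (there y∈) → there (proj₁ (∈-filterᵇ⁻ _ (S⊆ y∈))) }
    ... | no small =
      let S , |S| , tr , S⊆ = ramsey s (Unique.filter⁺ (T? ∘ (not ∘ arc 𝒯 x)) u)
                                (≤-trans big (≤-reflexive (sym (length-filterᵇ (not ∘ arc 𝒯 x) xs))))
      in S ++ [ x ] , trans (length-++ S) (trans (+-comm _ 1) (cong suc |S|)) ,
         AllPairs.++⁺ tr ([] ∷ []) (All.tabulate λ y∈ → back (S⊆ y∈) ∷ []) ,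
         λ y∈ → inside S⊆ (∈-++⁻ S y∈)
      where
      big : 2 ^ s ≤ count (not ∘ arc 𝒯 x) xs
      big = +-cancelˡ-≤ (2 ^ s) _ _ (begin
        2 ^ s + 2 ^ s                                          ≡⟨ cong (2 ^ s +_) (sym (+-identityʳ _)) ⟩
        2 ^ suc s                                              ≤⟨ le ⟩
        suc (length xs)                                        ≡⟨ cong suc (count-not (arc 𝒯 x) xs) ⟩
        suc (count (arc 𝒯 x) xs) + count (not ∘ arc 𝒯 x) xs   ≤⟨ +-monoˡ-≤ _ (≰⇒> small) ⟩
        2 ^ s + count (not ∘ arc 𝒯 x) xs ∎)
        where open ≤-Reasoning
      back : ∀ {y} → y ∈ filterᵇ (not ∘ arc 𝒯 x) xs → y ⟶ x
      back {y} y∈ = let y∈xs , h = ∈-filterᵇ⁻ (not ∘ arc 𝒯 x) y∈ in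
        trans (oriented 𝒯 x y (All.lookup x∉ y∈xs)) h
      inside : ∀ {S y} → S ⊆ filterᵇ (not ∘ arc 𝒯 x) xs → y ∈ S ⊎ y ∈ [ x ] → y ∈ x ∷ xs
      inside S⊆ (inj₁ y∈)          = there (proj₁ (∈-filterᵇ⁻ (not ∘ arc 𝒯 x) (S⊆ y∈)))
      inside S⊆ (inj₂ (here refl)) = here refl

    common : (V → Q → Bool) → List V → Q → Bool
    common r S b = all (λ a → r a b) S

    -- The form in which dependent random choice is used later: one number `G` bounds both the size
    -- required of `A` and the loss in common neighbours. The type `Q` is arbitrary so that `B` may
    -- also consist of pairs of vertices.
    Choosable : ℕ → ℕ → ℕ → Set₁
    Choosable D G s = ∀ {Q : Set} (r : V → Q → Bool) A B → 1 ≤ length B → Unique A → G ≤ length A →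
      (∀ {x} → x ∈ A → length B ≤ D * count (r x) B) →
      ∃ λ S → length S ≡ s × Transitive S × S ⊆ A × length B ≤ G * count (common r S) B

    -- Selection is run with all `s`-tuples having few common neighbours as the bad objects. The
    -- weight `a` on a bad tuple exceeds what the at most `a` surviving vertices can pay for, so no
    -- bad tuple survives; the surplus 2^s leaves enough vertices for `ramsey`.
    choose : ∀ {D M a s} {{_ : NonZero D}} {{_ : NonZero M}} →
      a * a ^ s * D ^ s + 2 ^ s * (D * M) ^ s ≤ a * M ^ s →
      (r : V → Q → Bool) (A : List V) (B : List Q) → 1 ≤ length B → Unique A → length A ≡ a →
      (∀ {x} → x ∈ A → length B ≤ D * count (r x) B) →
      ∃ λ S → length S ≡ s × Transitive S × S ⊆ A × length B ≤ M * count (common r S) B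
    choose {D = D} {M} {a} {s} potential r A B B≥1 uA |A| degA =
      S , |S| , tr , (λ y∈ → proj₁ (∈-filterᵇ⁻ _ (S⊆ y∈))) , good
      where
      open ≤-Reasoning
      bad : List V → Bool
      bad S = M * count (common r S) B ≤ᵇ length B
      Y : List (List V)
      Y = filterᵇ bad (listsOfLength s A)
      |Y| : length Y ≤ a ^ s
      |Y| = begin
        length Y                      ≡⟨ length-filterᵇ bad (listsOfLength s A) ⟩
        count bad (listsOfLength s A) ≤⟨ count≤length bad (listsOfLength s A) ⟩
        length (listsOfLength s A)    ≡⟨ length-listsOfLength s A ⟩
        length A ^ s                  ≡⟨ cong (_^ s) |A| ⟩
        a ^ s ∎
      open Selection r (common r) B D M a (2 ^ s) B≥1
      Selected : Set
      Selected = ∃ λ bs → a * count (λ S → all (common r S) bs) Y + 2 ^ s ≤ count (λ x → all (r x) bs) A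
      sel : Selected
      sel = select s A Y degA
        (λ y∈ → ≤ᵇ⇒≤ _ _ (Equivalence.from T-≡ (proj₂ (∈-filterᵇ⁻ bad {xs = listsOfLength s A} y∈))))
        (begin
          a * length Y * D ^ s + 2 ^ s * (D * M) ^ s  ≤⟨ +-monoˡ-≤ _ (*-monoˡ-≤ (D ^ s) (*-monoʳ-≤ a |Y|)) ⟩
          a * a ^ s * D ^ s + 2 ^ s * (D * M) ^ s     ≤⟨ potential ⟩
          a * M ^ s                                   ≡⟨ cong (_* M ^ s) (sym |A|) ⟩
          length A * M ^ s ∎)
      bs : List _
      bs = proj₁ sel
      surviving : ℕ
      surviving = count (λ S → all (common r S) bs) Y
      A′ : List V
      A′ = filterᵇ (λ x → all (r x) bs) A
      noBad : ¬ (1 ≤ surviving)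
      noBad h = <⇒≱ (begin-strict
        a                                 <⟨ m<m+n a (m^n>0 2 s) ⟩
        a + 2 ^ s                         ≡⟨ cong (_+ 2 ^ s) (sym (*-identityʳ a)) ⟩
        a * 1 + 2 ^ s                     ≤⟨ +-monoˡ-≤ (2 ^ s) (*-monoʳ-≤ a h) ⟩
        a * surviving + 2 ^ s             ≤⟨ proj₂ sel ⟩
        count (λ x → all (r x) bs) A ∎) (≤-trans (count≤length _ A) (≤-reflexive |A|))
      ram : ∃ λ S → length S ≡ s × Transitive S × S ⊆ A′
      ram = ramsey s {A′} (Unique.filter⁺ _ uA) (begin
        2 ^ s                             ≤⟨ m≤n+m (2 ^ s) (a * surviving) ⟩
        a * surviving + 2 ^ s             ≤⟨ proj₂ sel ⟩
        count (λ x → all (r x) bs) A      ≡⟨ sym (length-filterᵇ _ A) ⟩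
        length A′ ∎)
      S : List V
      S = proj₁ ram
      |S| : length S ≡ s
      |S| = proj₁ (proj₂ ram)
      tr : Transitive S
      tr = proj₁ (proj₂ (proj₂ ram))
      S⊆ : S ⊆ A′
      S⊆ = proj₂ (proj₂ (proj₂ ram))
      -- Every vertex of `S` is related to every sample, so `S` survives as a tuple as well and
      -- would be a surviving bad tuple if it were bad.
      S-survives : all (common r S) bs ≡ true
      S-survives = all-intro _ bs λ {b} b∈ → all-intro _ S λ y∈ →
        all-elim _ bs (proj₂ (∈-filterᵇ⁻ (λ x → all (r x) bs) {xs = A} (S⊆ y∈))) b∈
      good : length B ≤ M * count (common r S) B
      bad∉ : ¬ (M * count (common r S) B ≤ length B)
      bad∉ isBad = noBad (∈⇒count≥1 (λ S → all (common r S) bs) S∈Y S-survives)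
        where
        S∈Y : S ∈ Y
        S∈Y = ∈-filterᵇ⁺ bad {x = S} {xs = listsOfLength s A}
          (subst (λ l → S ∈ listsOfLength l A) |S|
            (∈-listsOfLength S (λ y∈ → proj₁ (∈-filterᵇ⁻ (λ x → all (r x) bs) {xs = A} (S⊆ y∈)))))
          (Equivalence.to T-≡ (≤⇒≤ᵇ isBad))
      good = <⇒≤ (≰⇒> bad∉)

    -- `A` is cut down to exactly `D ^ (2 * s + 1)` vertices, since the number of bad tuples has to
    -- be bounded independently of the size of `A`.
    dependentRandomChoice : ∀ {D s} → 4 ≤ D → 1 ≤ s → (r : V → Q → Bool) (A : List V) (B : List Q) →
      1 ≤ length B → Unique A → D ^ (2 * s + 1) ≤ length A → (∀ {x} → x ∈ A → length B ≤ D * count (r x) B) →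
      ∃ λ S → length S ≡ s × Transitive S × S ⊆ A × length B ≤ D ^ (2 * s + 4) * count (common r S) B
    dependentRandomChoice {D = D} {s} 4≤D 1≤s r A B B≥1 uA A-large degA =
      let S , |S| , tr , S⊆ , good = choose {D = D} {M = D ^ (2 * s + 4)} {a = a} {s = s} {{D≢0}} {{m^n≢0 D (2 * s + 4) {{D≢0}}}}
            (potential-bound 4≤D 1≤s) r (take a A) B B≥1 (Unique.take⁺ a uA)
            (trans (length-take a A) (m≤n⇒m⊓n≡m A-large)) (λ x∈ → degA (take-⊆ a A x∈))
      in S , |S| , tr , (λ y∈ → take-⊆ a A (S⊆ y∈)) , good
      where
      a : ℕ
      a = D ^ (2 * s + 1)
      D≢0 : NonZero D
      D≢0 = >-nonZero (≤-trans (s≤s z≤n) 4≤D)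

  -- Orders with few backward arcs, and the core

  unique-resp-↭ : ∀ {xs ys : List A} → xs ↭ ys → Unique xs → Unique ys
  unique-resp-↭ {A} p = PermSetoid.Unique-resp-↭ (setoid A) (↭⇒↭ₛ p)

  filter-partition-↭ : ∀ (p : A → Bool) xs → filterᵇ (not ∘ p) xs ++ filterᵇ p xs ↭ xs
  filter-partition-↭ p [] = Perm.refl
  filter-partition-↭ p (x ∷ xs) with p x
  ... | false = prep x (filter-partition-↭ p xs)
  ... | true  = ↭-trans (Perm.shift x (filterᵇ (not ∘ p) xs) (filterᵇ p xs)) (prep x (filter-partition-↭ p xs))

  module Orders {n : ℕ} (𝒯 : Tournament n) where
    open TournamentLists 𝒯

    back : List V → ℕ
    back []       = 0
    back (x ∷ xs) = count (λ y → arc 𝒯 y x) xs + back xs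

    cross : List V → List V → ℕ
    cross xs ys = sumOf xs (λ x → count (λ y → arc 𝒯 y x) ys)

    back-++ : ∀ xs ys → back (xs ++ ys) ≡ back xs + back ys + cross xs ys
    back-++ []       ys = sym (+-identityʳ (back ys))
    back-++ (x ∷ xs) ys = trans (cong₂ _+_ (sum-++ xs ys _) (back-++ xs ys))
      (eq (count (λ y → arc 𝒯 y x) xs) (count (λ y → arc 𝒯 y x) ys) (back xs) (back ys) (cross xs ys))
      where
      eq : ∀ a b c d e → a + b + (c + d + e) ≡ a + c + d + (b + e)
      eq = solve-∀

    arcsAcross : (V → Bool) → List V → ℕ
    arcsAcross p U = sumOf U (λ a → 𝟙 (p a) * count (λ b → not (p b) ∧ arc 𝒯 a b) U)

    -- The complement of `p` is ordered first, so the backward arcs between the parts are exactly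
    -- those leaving `p`.
    cross-partition : ∀ p U {π ρ} → π ↭ filterᵇ (not ∘ p) U → ρ ↭ filterᵇ p U → cross π ρ ≡ arcsAcross p U
    cross-partition p U {π} {ρ} π↭ ρ↭ = begin
      sumOf π (λ x → count (λ y → arc 𝒯 y x) ρ)      ≡⟨ sum-swap π ρ (λ x y → 𝟙 (arc 𝒯 y x)) ⟩
      sumOf ρ (λ y → count (arc 𝒯 y) π)              ≡⟨ sum-↭ _ ρ↭ ⟩
      sumOf Uₚ (λ y → count (arc 𝒯 y) π)             ≡⟨ sum-cong Uₚ (λ y → sum-↭ (𝟙 ∘ arc 𝒯 y) π↭) ⟩
      sumOf Uₚ (λ y → count (arc 𝒯 y) U¬ₚ)           ≡⟨ sum-cong Uₚ (λ y → count-filter (not ∘ p) (arc 𝒯 y) U) ⟩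
      sumOf Uₚ (λ y → count (λ b → not (p b) ∧ arc 𝒯 y b) U) ≡⟨ sum-filter p U _ ⟩
      arcsAcross p U ∎
      where
      open ≡-Reasoning
      Uₚ U¬ₚ : List V
      Uₚ  = filterᵇ p U
      U¬ₚ = filterᵇ (not ∘ p) U

    arcsAcross-cong : ∀ {p q} U → (∀ v → p v ≡ q v) → arcsAcross p U ≡ arcsAcross q U
    arcsAcross-cong U h = sum-cong U λ a → cong₂ _*_ (cong 𝟙 (h a))
      (count-cong U λ b → cong (λ z → not z ∧ arc 𝒯 a b) (h b))

    -- Only arcs leaving `p` are counted, but `p` ranges over all predicates, so both directions of
    -- every cut are dense. The strict inequality supplies the extra 1 needed in `inDegree`.
    CutDense : ℕ → List V → Set
    CutDense E U = ∀ p → 1 ≤ count p U → 1 ≤ count (not ∘ p) U →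
      count p U * count (not ∘ p) U < E * arcsAcross p U

    -- `K-degree` is relative to `n` and not to the size of `U`; together with `K≥1` it forces K,
    -- and hence U, to have at least n/2E vertices.
    record Core (E : ℕ) : Set where
      field
        U        : List V
        U-unique : Unique U
        U-dense  : CutDense E U
        K        : List V
        K-unique : Unique K
        K≥1      : 1 ≤ length K
        K⊆U      : K ⊆ U
        K-degree : ∀ {v} → v ∈ K → n ≤ 2 * E * count (arc 𝒯 v) K

    Hub : ℕ → List V → Set
    Hub E U = ∃ λ K → Unique K × 1 ≤ length K × K ⊆ U × (∀ {v} → v ∈ K → n ≤ 2 * E * count (arc 𝒯 v) K)

    -- A vertex placed last creates one backward arc for each of its out-neighbours in the list,
    -- fewer than n/2E if its out-degree is small. Either such vertices can be removed until nothing
    -- is left, or the removal stops at a hub.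
    peel : ∀ E m U → length U ≡ m → Unique U →
           Hub E U ⊎ ∃ λ π → π ↭ U × 2 * E * back π ≤ n * length U
    peel E m [] _ _ = inj₂ ([] , Perm.refl , ≤-reflexive (trans (*-zeroʳ (2 * E)) (sym (*-zeroʳ n))))
    peel E (suc m) U@(_ ∷ _) |U| uU with All.all? (λ v → n ≤? 2 * E * count (arc 𝒯 v) U) U
    ... | yes h = inj₁ (U , uU , s≤s z≤n , (λ x → x) , All.lookup h)
    ... | no ¬h with find (All.¬All⇒Any¬ (λ v → n ≤? 2 * E * count (arc 𝒯 v) U) U ¬h)
    ...   | v , v∈ , ¬deg with ∈-∃++ v∈
    ...     | ys , zs , U≡ = go (peel E m U′ (suc-injective (trans (sym (Perm.↭-length U↭)) |U|)) uU′)
      where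
      U′ : List V
      U′ = ys ++ zs
      U↭ : U ↭ v ∷ U′
      U↭ = subst (_↭ v ∷ U′) (sym U≡) (Perm.shift v ys zs)
      uU′ : Unique U′
      uU′ = AllPairs.tail (unique-resp-↭ U↭ uU)
      go : Hub E U′ ⊎ (∃ λ π → π ↭ U′ × 2 * E * back π ≤ n * length U′) →
           Hub E U ⊎ ∃ λ π → π ↭ U × 2 * E * back π ≤ n * length U
      go (inj₁ (K , uK , K≥1 , K⊆ , deg)) =
        inj₁ (K , uK , K≥1 , (λ x∈ → Perm.∈-resp-↭ (↭-sym U↭) (there (K⊆ x∈))) , deg)
      go (inj₂ (π , π↭ , le)) = inj₂ (π ++ [ v ] , ↭-trans (↭-sym (Perm.∷↭∷ʳ v π)) (↭-trans (prep v π↭) (↭-sym U↭)) , (begin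
        2 * E * back (π ++ [ v ])                  ≡⟨ cong (2 * E *_) (back-++ π [ v ]) ⟩
        2 * E * (back π + 0 + cross π [ v ])       ≡⟨ eq (2 * E) (back π) (cross π [ v ]) ⟩
        2 * E * back π + 2 * E * cross π [ v ]
          ≤⟨ +-mono-≤ le (≤-trans (*-monoʳ-≤ (2 * E) cross≤) (<⇒≤ (≰⇒> ¬deg))) ⟩
        n * length U′ + n                          ≡⟨ trans (+-comm _ n) (sym (*-suc n (length U′))) ⟩
        n * suc (length U′)                        ≡⟨ cong (n *_) (sym (Perm.↭-length U↭)) ⟩
        n * length U ∎))
        where
        open ≤-Reasoning
        eq : ∀ e a b → e * (a + 0 + b) ≡ e * a + e * b
        eq = solve-∀
        cross≤ : cross π [ v ] ≤ count (arc 𝒯 v) U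
        cross≤ = begin
          sumOf π (λ x → 𝟙 (arc 𝒯 v x) + 0)  ≡⟨ sum-cong π (λ x → +-identityʳ _) ⟩
          count (arc 𝒯 v) π                  ≡⟨ sum-↭ _ π↭ ⟩
          count (arc 𝒯 v) U′                 ≤⟨ m≤n+m _ (𝟙 (arc 𝒯 v v)) ⟩
          count (arc 𝒯 v) (v ∷ U′)           ≡⟨ sum-↭ _ (↭-sym U↭) ⟩
          count (arc 𝒯 v) U ∎

    -- Cuts are encoded as `Subset n` because existence over subsets is decidable by `anySubset?`;
    -- `noSparseCut⇒dense` carries the result over to arbitrary Boolean predicates.
    SparseCut : ℕ → List V → Subset n → Set
    SparseCut E U s = 1 ≤ count p U × 1 ≤ count (not ∘ p) U × E * arcsAcross p U ≤ count p U * count (not ∘ p) U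
      where
      p : V → Bool
      p = Vec.lookup s

    sparseCut? : ∀ E U s → Dec (SparseCut E U s)
    sparseCut? E U s = (1 ≤? _) ×-dec (1 ≤? _) ×-dec (_ ≤? _)

    noSparseCut⇒dense : ∀ E U → ¬ ∃ (SparseCut E U) → CutDense E U
    noSparseCut⇒dense E U none p p≥1 ¬p≥1 = ≰⇒> λ sparse → none (Vec.tabulate p ,
      subst (1 ≤_) eqₚ p≥1 , subst (1 ≤_) eq¬ₚ ¬p≥1 ,
      subst₂ _≤_ (cong (E *_) (arcsAcross-cong U (sym ∘ lookup∘tabulate p))) (cong₂ _*_ eqₚ eq¬ₚ) sparse)
      where
      eqₚ : count p U ≡ count (Vec.lookup (Vec.tabulate p)) U
      eqₚ = count-cong U (sym ∘ lookup∘tabulate p)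
      eq¬ₚ : count (not ∘ p) U ≡ count (not ∘ Vec.lookup (Vec.tabulate p)) U
      eq¬ₚ = count-cong U (cong not ∘ sym ∘ lookup∘tabulate p)

    -- When U splits along a sparse cut, |U|² exceeds the sum of the squares of the parts by enough to
    -- pay for the arcs across the cut.
    NearlyTransitive : ℕ → List V → Set
    NearlyTransitive E U = ∃ λ π → π ↭ U × 2 * E * back π < n * length U + length U * length U

    combine : ∀ E U p → E * arcsAcross p U ≤ count p U * count (not ∘ p) U →
      NearlyTransitive E (filterᵇ (not ∘ p) U) → NearlyTransitive E (filterᵇ p U) → NearlyTransitive E U
    combine E U p sparse (π , π↭ , π<) (ρ , ρ↭ , ρ<) =
      π ++ ρ , ↭-trans (Perm.++⁺ π↭ ρ↭) (filter-partition-↭ p U) , (begin-strict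
        2 * E * back (π ++ ρ)                                   ≡⟨ cong (2 * E *_) (back-++ π ρ) ⟩
        2 * E * (back π + back ρ + cross π ρ)
          ≡⟨ cong (λ z → 2 * E * (back π + back ρ + z)) (cross-partition p U π↭ ρ↭) ⟩
        2 * E * (back π + back ρ + arcsAcross p U)              ≡⟨ eq₁ E (back π) (back ρ) (arcsAcross p U) ⟩
        2 * E * back π + 2 * E * back ρ + 2 * (E * arcsAcross p U) <⟨ +-mono-<-≤ (+-mono-< π< ρ<) (*-monoʳ-≤ 2 sparse) ⟩
        n * length U¬ₚ + length U¬ₚ * length U¬ₚ + (n * length Uₚ + length Uₚ * length Uₚ) + 2 * (count p U * count (not ∘ p) U)
          ≡⟨ cong₂ (λ a b → n * a + a * a + (n * b + b * b) + 2 * (count p U * count (not ∘ p) U)) (length-filterᵇ (not ∘ p) U) (length-filterᵇ p U) ⟩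
        n * c¬ₚ + c¬ₚ * c¬ₚ + (n * cₚ + cₚ * cₚ) + 2 * (cₚ * c¬ₚ) ≡⟨ eq₂ n cₚ c¬ₚ ⟩
        n * (cₚ + c¬ₚ) + (cₚ + c¬ₚ) * (cₚ + c¬ₚ)                 ≡⟨ cong (λ z → n * z + z * z) (sym (count-not p U)) ⟩
        n * length U + length U * length U ∎)
      where
      open ≤-Reasoning
      Uₚ U¬ₚ : List V
      Uₚ  = filterᵇ p U
      U¬ₚ = filterᵇ (not ∘ p) U
      cₚ c¬ₚ : ℕ
      cₚ  = count p U
      c¬ₚ = count (not ∘ p) U
      eq₁ : ∀ E a b c → 2 * E * (a + b + c) ≡ 2 * E * a + 2 * E * b + 2 * (E * c)
      eq₁ = solve-∀
      eq₂ : ∀ n a b → n * b + b * b + (n * a + a * a) + 2 * (a * b) ≡ n * (a + b) + (a + b) * (a + b)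
      eq₂ = solve-∀

    core-or-order : ∀ E m U → length U ≤ m → Unique U → 1 ≤ length U → Core E ⊎ NearlyTransitive E U
    core-or-order E zero    U |U| uU U≥1 = contradiction (≤-trans U≥1 |U|) λ ()
    core-or-order E (suc m) U |U| uU U≥1 with anySubset? (sparseCut? E U)
    ... | yes (s , p≥1 , ¬p≥1 , sparse) = go
      (core-or-order E m (filterᵇ (not ∘ p) U) (smaller¬ₚ) (Unique.filter⁺ _ uU) (≤-trans ¬p≥1 (≤-reflexive (sym (length-filterᵇ (not ∘ p) U)))))
      (core-or-order E m (filterᵇ p U) smallerₚ (Unique.filter⁺ _ uU) (≤-trans p≥1 (≤-reflexive (sym (length-filterᵇ p U)))))
      where
      open ≤-Reasoning
      p : V → Bool
      p = Vec.lookup s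
      smaller¬ₚ : length (filterᵇ (not ∘ p) U) ≤ m
      smaller¬ₚ = s≤s⁻¹ (begin
        suc (length (filterᵇ (not ∘ p) U)) ≡⟨ cong suc (length-filterᵇ (not ∘ p) U) ⟩
        1 + count (not ∘ p) U              ≤⟨ +-monoˡ-≤ _ p≥1 ⟩
        count p U + count (not ∘ p) U      ≡⟨ sym (count-not p U) ⟩
        length U                           ≤⟨ |U| ⟩
        suc m ∎)
      smallerₚ : length (filterᵇ p U) ≤ m
      smallerₚ = s≤s⁻¹ (begin
        suc (length (filterᵇ p U))         ≡⟨ cong suc (length-filterᵇ p U) ⟩
        1 + count p U                      ≤⟨ +-monoˡ-≤ _ ¬p≥1 ⟩
        count (not ∘ p) U + count p U      ≡⟨ +-comm _ (count p U) ⟩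
        count p U + count (not ∘ p) U      ≡⟨ sym (count-not p U) ⟩
        length U                           ≤⟨ |U| ⟩
        suc m ∎)
      go : Core E ⊎ NearlyTransitive E (filterᵇ (not ∘ p) U) → Core E ⊎ NearlyTransitive E (filterᵇ p U) → Core E ⊎ NearlyTransitive E U
      go (inj₁ c) _        = inj₁ c
      go (inj₂ _) (inj₁ c) = inj₁ c
      go (inj₂ a) (inj₂ b) = inj₂ (combine E U p sparse a b)
    ... | no none with peel E (length U) U refl uU
    ...   | inj₁ (K , uK , K≥1 , K⊆ , deg) = inj₁ (record
      { U = U ; U-unique = uU ; U-dense = noSparseCut⇒dense E U none
      ; K = K ; K-unique = uK ; K≥1 = K≥1 ; K⊆U = K⊆ ; K-degree = deg })
    -- The square of the length is positive on a nonempty piece. This makes the bound strict, and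
    -- the strictness is what later contradicts intransitivity.
    ...   | inj₂ (π , π↭ , le) = inj₂ (π , π↭ , ≤-<-trans le (m<m+n _ (*-mono-≤ U≥1 U≥1)))

  -- Path powers from chains of blobs, and their closing to a cycle power

  lookup-injective : ∀ {xs : List A} → Unique xs → Injective _≡_ _≡_ (lookup xs)
  lookup-injective (x∉ ∷ u) {zero}  {zero}  eq = refl
  lookup-injective (x∉ ∷ u) {zero}  {suc j} eq = contradiction eq (All.lookup x∉ (∈-lookup j))
  lookup-injective (x∉ ∷ u) {suc i} {zero}  eq = contradiction (sym eq) (All.lookup x∉ (∈-lookup i))
  lookup-injective (x∉ ∷ u) {suc i} {suc j} eq = cong suc (lookup-injective u eq)

  ∈-take-++⁻ : ∀ k (xs : List A) {ys y} → y ∈ take k (xs ++ ys) → y ∈ xs ⊎ y ∈ take k ys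
  ∈-take-++⁻ k       []       y∈          = inj₂ y∈
  ∈-take-++⁻ (suc k) (x ∷ xs) (here refl) = inj₁ (here refl)
  ∈-take-++⁻ (suc k) (x ∷ xs) {ys} (there y∈) with ∈-take-++⁻ k xs y∈
  ... | inj₁ y∈xs = inj₁ (there y∈xs)
  ... | inj₂ y∈ys = inj₂ (take-mono k ys y∈ys)
    where
    take-mono : ∀ k (ys : List A) {y} → y ∈ take k ys → y ∈ take (suc k) ys
    take-mono (suc k) (_ ∷ ys) (here refl) = here refl
    take-mono (suc k) (_ ∷ ys) (there y∈)  = there (take-mono k ys y∈)

  ∈-take-short : ∀ k (xs : List A) {ys y} → k ≤ length xs → y ∈ take k (xs ++ ys) → y ∈ xs
  ∈-take-short (suc k) (x ∷ xs) le (here refl) = here refl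
  ∈-take-short (suc k) (x ∷ xs) le (there y∈)  = there (∈-take-short k xs (s≤s⁻¹ le) y∈)

  -- Positions are plain numbers so that an entry keeps its position when a list is appended, and an
  -- entry of the appended list is reached by adding a length.
  At : List A → ℕ → A → Set
  At []       p       v = ⊥
  At (x ∷ xs) zero    v = x ≡ v
  At (x ∷ xs) (suc p) v = At xs p v

  at-lookup : ∀ (xs : List A) i → At xs (toℕ i) (lookup xs i)
  at-lookup (x ∷ xs) zero    = refl
  at-lookup (x ∷ xs) (suc i) = at-lookup xs i

  at-++⁺ˡ : ∀ (xs : List A) {ys p v} → At xs p v → At (xs ++ ys) p v
  at-++⁺ˡ (x ∷ xs) {p = zero}  a = a
  at-++⁺ˡ (x ∷ xs) {p = suc p} a = at-++⁺ˡ xs a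

  at-++⁺ʳ : ∀ (xs : List A) {ys p v} → At ys p v → At (xs ++ ys) (length xs + p) v
  at-++⁺ʳ []       a = a
  at-++⁺ʳ (x ∷ xs) a = at-++⁺ʳ xs a

  at-++⁻ˡ : ∀ (xs : List A) {ys p v} → p < length xs → At (xs ++ ys) p v → At xs p v
  at-++⁻ˡ (x ∷ xs) {p = zero}  lt a = a
  at-++⁻ˡ (x ∷ xs) {p = suc p} lt a = at-++⁻ˡ xs (s≤s⁻¹ lt) a

  module Paths {n : ℕ} (𝒯 : Tournament n) where
    open TournamentLists 𝒯

    infix 4 _⇛_
    _⇛_ : List V → List V → Set
    S ⇛ R = ∀ {x y} → x ∈ S → y ∈ R → x ⟶ y

    PathPower : ℕ → List V → Set
    PathPower k []       = ⊤
    PathPower k (x ∷ xs) = (∀ {y} → y ∈ take k xs → x ⟶ y) × PathPower k xs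

    -- As `c` has at least `k` entries, the next `k` entries after one of `b` lie in `b` or in `c`:
    -- the former are dominated by transitivity, the latter by `b ⇛ c`.
    pathPower-++ : ∀ {k} b {c zs} → Transitive b → b ⇛ c → k ≤ length c →
                   PathPower k (c ++ zs) → PathPower k (b ++ (c ++ zs))
    pathPower-++ []      _         _   _    pp = pp
    pathPower-++ {k} (x ∷ b) {c} {zs} (x⟶ ∷ tr) b⇛c k≤c pp =
      (λ y∈ → [ All.lookup x⟶ , (λ y∈′ → b⇛c (here refl) (∈-take-short k c k≤c y∈′)) ]′ (∈-take-++⁻ k b y∈)) ,
      pathPower-++ b tr (b⇛c ∘ there) k≤c pp

    transitive⇒pathPower : ∀ {k} b → Transitive b → PathPower k b
    transitive⇒pathPower []      _         = tt
    transitive⇒pathPower {k} (x ∷ b) (x⟶ ∷ tr) = All.lookup x⟶ ∘ take-⊆ k b , transitive⇒pathPower b tr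

    Blob : ℕ → List V → Set
    Blob k b = Transitive b × k ≤ length b

    linked⇒pathPower : ∀ {k} bs → All (Blob k) bs → Linked _⇛_ bs → PathPower k (concat bs)
    linked⇒pathPower []           _                  _         = tt
    linked⇒pathPower (b ∷ [])     ((tr , _) ∷ _)     _         =
      subst (PathPower _) (sym (++-identityʳ b)) (transitive⇒pathPower b tr)
    linked⇒pathPower (b ∷ c ∷ bs) ((tr , _) ∷ blobs@((_ , k≤c) ∷ _)) (b⇛c ∷ l) =
      pathPower-++ b tr b⇛c k≤c (linked⇒pathPower (c ∷ bs) blobs l)

    at-take : ∀ k (xs : List V) {p v} → p < k → At xs p v → v ∈ take k xs
    at-take (suc k) (x ∷ xs) {zero}  lt refl = here refl
    at-take (suc k) (x ∷ xs) {suc p} lt a    = there (at-take k xs (s≤s⁻¹ lt) a)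

    pathPower-at : ∀ {k} L {p q v w} → PathPower k L → At L p v → At L q w → p < q → q ≤ p + k → v ⟶ w
    pathPower-at {k} (x ∷ L) {zero}  {suc q} (x⟶ , pp) refl b _  q≤ = x⟶ (at-take k L q≤ b)
    pathPower-at {k} (x ∷ L) {suc p} {suc q} (_  , pp) a    b lt q≤ = pathPower-at L pp a b (s≤s⁻¹ lt) (s≤s⁻¹ q≤)

    -- Appending the first blob a second time turns the wrap-around arcs into arcs of a path power.
    closed-walk⇒cyclePower : ∀ {k} S bs → All (Blob k) (S ∷ bs) → Linked _⇛_ (S ∷ bs ++ [ S ]) →
      Unique (concat (S ∷ bs)) → let L = concat (S ∷ bs) in IsCyclePower 𝒯 k (length L) (lookup L)
    closed-walk⇒cyclePower {k} S bs blobs@((tr , k≤S) ∷ rest) linked unique = lookup-injective unique , arcs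
      where
      L : List V
      L = concat (S ∷ bs)
      m : ℕ
      m = length L
      k≤m : k ≤ m
      k≤m = ≤-trans k≤S (≤-trans (m≤m+n _ _) (≤-reflexive (sym (length-++ S))))
      all-++ : ∀ {xs ys : List (List V)} → All (Blob k) xs → All (Blob k) ys → All (Blob k) (xs ++ ys)
      all-++ []       q = q
      all-++ (p ∷ ps) q = p ∷ all-++ ps q
      concat≡ : concat (S ∷ bs ++ [ S ]) ≡ L ++ S
      concat≡ = trans (sym (concat-++ (S ∷ bs) [ S ])) (cong (L ++_) (++-identityʳ S))
      pp : PathPower k (L ++ S)
      pp = subst (PathPower k) concat≡ (linked⇒pathPower _ (all-++ blobs ((tr , k≤S) ∷ [])) linked)
      arcs : ∀ (i j : Fin m) d → 1 ≤ d → d ≤ k → ∃ (λ q → toℕ i + d ≡ toℕ j + q * m) → lookup L i ⟶ lookup L j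
      arcs i j d 1≤d d≤k (zero , eq) = pathPower-at (L ++ S) pp
        (at-++⁺ˡ L (at-lookup L i)) (at-++⁺ˡ L (at-lookup L j))
        (≤-trans (m<m+n (toℕ i) 1≤d) (≤-reflexive eq′))
        (≤-trans (≤-reflexive (sym eq′)) (+-monoʳ-≤ (toℕ i) d≤k))
        where
        eq′ : toℕ i + d ≡ toℕ j
        eq′ = trans eq (+-identityʳ _)
      arcs i j d 1≤d d≤k (suc zero , eq) = pathPower-at (L ++ S) pp
        (at-++⁺ˡ L (at-lookup L i)) (at-++⁺ʳ L (at-++⁻ˡ S j<S (at-lookup L j)))
        (≤-trans (toℕ<n i) (m≤m+n m (toℕ j)))
        (≤-trans (≤-reflexive (sym eq′)) (+-monoʳ-≤ (toℕ i) d≤k))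
        where
        eq′ : toℕ i + d ≡ m + toℕ j
        eq′ = trans eq (trans (cong (toℕ j +_) (+-identityʳ m)) (+-comm (toℕ j) m))
        -- An arc that wraps around ends within the first blob, because d ≤ k ≤ |S|; its head is
        -- thus also found in the second copy of `S`, at position m + j.
        j<S : toℕ j < length S
        j<S = +-cancelˡ-< m _ _ (begin-strict
          m + toℕ j  ≡⟨ sym eq′ ⟩
          toℕ i + d  <⟨ +-mono-<-≤ (toℕ<n i) (≤-trans d≤k k≤S) ⟩
          m + length S ∎)
          where open ≤-Reasoning
      -- Two full turns are impossible since i < m and d ≤ k ≤ m.
      arcs i j d 1≤d d≤k (suc (suc q) , eq) = contradiction (begin-strict
        toℕ i + d                  <⟨ +-mono-<-≤ (toℕ<n i) (≤-trans d≤k k≤m) ⟩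
        m + m                      ≤⟨ +-monoʳ-≤ m (m≤m+n m (q * m)) ⟩
        suc (suc q) * m            ≤⟨ m≤n+m _ (toℕ j) ⟩
        toℕ j + suc (suc q) * m    ≡⟨ sym eq ⟩
        toℕ i + d ∎) (<-irrefl refl)
        where open ≤-Reasoning

  -- Vertex lists as finite sets

  module Membership {n : ℕ} where
    open DecMembership (Fin._≟_ {n}) using (_∈?_)

    mem : Fin n → List (Fin n) → Bool
    mem v W = does (v ∈? W)

    ∈⇒mem : ∀ {v W} → v ∈ W → mem v W ≡ true
    ∈⇒mem {v} {W} = dec-true (v ∈? W)

    mem⇒∈ : ∀ {v W} → mem v W ≡ true → v ∈ W
    mem⇒∈ {v} {W} h with v ∈? W
    ... | yes v∈ = v∈

    ∉⇒not-mem : ∀ {v W} → v ∉ W → not (mem v W) ≡ true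
    ∉⇒not-mem {v} {W} h = cong not (dec-false (v ∈? W) h)

    not-mem⇒∉ : ∀ {v W} → not (mem v W) ≡ true → v ∉ W
    not-mem⇒∉ {v} {W} h v∈ with () ← trans (sym h) (cong not (∈⇒mem {v} {W} v∈))

    count-≟ : ∀ (w : Fin n) {U} → Unique U → count (λ v → does (v Fin.≟ w)) U ≤ 1
    count-≟ w [] = z≤n
    count-≟ w {v ∷ U} (v∉ ∷ u) with v Fin.≟ w
    ... | no  _    = count-≟ w u
    ... | yes refl = s≤s (≤-reflexive (trans (sum-0 U v∉) refl))
      where
      sum-0 : ∀ U → All (v ≢_) U → count (λ x → does (x Fin.≟ v)) U ≡ 0
      sum-0 []      _          = refl
      sum-0 (x ∷ U) (v≢x ∷ v∉) = cong₂ _+_ (cong 𝟙 (dec-false (x Fin.≟ v) (v≢x ∘ sym))) (sum-0 U v∉)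

    -- Double counting of equal pairs. Repetitions in `W` are allowed, since the lists made by
    -- `forbid` may contain them.
    count-mem : ∀ W {U} → Unique U → count (λ v → mem v W) U ≤ length W
    count-mem W {U} uU = begin
      count (λ v → mem v W) U                          ≤⟨ sum-mono U (λ {v} _ → hit v) ⟩
      sumOf U (λ v → count (λ w → does (v Fin.≟ w)) W) ≡⟨ sum-swap U W (λ v w → 𝟙 (does (v Fin.≟ w))) ⟩
      sumOf W (λ w → count (λ v → does (v Fin.≟ w)) U) ≤⟨ sum-mono W (λ {w} _ → count-≟ w uU) ⟩
      sumOf W (λ _ → 1)                                ≡⟨ trans (sum-const W 1) (*-identityʳ _) ⟩
      length W ∎
      where
      open ≤-Reasoning
      hit : ∀ v → 𝟙 (mem v W) ≤ count (λ w → does (v Fin.≟ w)) W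
      hit v with v ∈? W
      ... | yes v∈ = ∈⇒count≥1 _ v∈ (dec-true (v Fin.≟ v) refl)
      ... | no _   = z≤n

    count-avoid : ∀ p W {U} → Unique U → count p U ≤ count (λ v → p v ∧ not (mem v W)) U + length W
    count-avoid p W {U} uU = begin
      count p U                                                                   ≡⟨ count-∧-not p (λ v → mem v W) U ⟩
      count (λ v → p v ∧ mem v W) U + count (λ v → p v ∧ not (mem v W)) U
        ≤⟨ +-monoˡ-≤ _ (≤-trans (count-mono U (λ {v} _ → ∧-elimʳ {p v})) (count-mem W uU)) ⟩
      length W + count (λ v → p v ∧ not (mem v W)) U                               ≡⟨ +-comm (length W) _ ⟩
      count (λ v → p v ∧ not (mem v W)) U + length W ∎
      where open ≤-Reasoning

    unique-⊆⇒length≤ : ∀ {A B : List (Fin n)} → Unique A → A ⊆ B → length A ≤ length B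
    unique-⊆⇒length≤ {A} {B} uA A⊆B = begin
      length A                 ≡⟨ sym (trans (sum-const A 1) (*-identityʳ _)) ⟩
      sumOf A (λ _ → 1)        ≤⟨ sum-mono A (λ v∈ → ≤-reflexive (cong 𝟙 (sym (∈⇒mem (A⊆B v∈))))) ⟩
      count (λ v → mem v B) A  ≤⟨ count-mem B uA ⟩
      length B ∎
      where open ≤-Reasoning

    unique-length≤n : ∀ {A : List (Fin n)} → Unique A → length A ≤ n
    unique-length≤n {A} uA = ≤-trans (unique-⊆⇒length≤ uA (λ {v} _ → ∈-allFin v)) (≤-reflexive (length-tabulate (λ (i : Fin n) → i)))

    count-⊆ : ∀ p {A B : List (Fin n)} → Unique A → A ⊆ B → count p A ≤ count p B
    count-⊆ p {A} {B} uA A⊆B = subst₂ _≤_ (length-filterᵇ p A) (length-filterᵇ p B)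
      (unique-⊆⇒length≤ (Unique.filter⁺ _ uA) λ v∈ →
        let v∈A , pv = ∈-filterᵇ⁻ p {xs = A} v∈ in ∈-filterᵇ⁺ p (A⊆B v∈A) pv)

    -- Used to thin out the common in-neighbours of the starting blob: the first layer can be shown
    -- to be large only over a set filling at most half of `U`.
    truncate : ∀ p m {U} → Unique U → m ≤ count p U → ∃ λ q → (∀ {v} → q v ≡ true → p v ≡ true) × count q U ≡ m
    truncate p m {U} uU m≤ = (λ v → mem v W) ,
      (λ h → proj₂ (∈-filterᵇ⁻ p {xs = U} (take-⊆ m _ (mem⇒∈ h)))) ,
      ≤-antisym (≤-trans (count-mem W uU) (≤-reflexive |W|)) (begin
        m                                       ≡⟨ sym |W| ⟩
        length W
          ≤⟨ unique-⊆⇒length≤ {W} {filterᵇ (λ v → mem v W) U} uW (λ v∈ → ∈-filterᵇ⁺ (λ v → mem v W) (proj₁ (∈-filterᵇ⁻ p {xs = U} (take-⊆ m (filterᵇ p U) v∈))) (∈⇒mem v∈)) ⟩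
        length (filterᵇ (λ v → mem v W) U)      ≡⟨ length-filterᵇ (λ v → mem v W) U ⟩
        count (λ v → mem v W) U ∎)
      where
      open ≤-Reasoning
      W : List (Fin n)
      W = take m (filterᵇ p U)
      uW : Unique W
      uW = Unique.take⁺ m (Unique.filter⁺ _ uU)
      |W| : length W ≡ m
      |W| = trans (length-take m (filterᵇ p U)) (m≤n⇒m⊓n≡m (≤-trans m≤ (≤-reflexive (sym (length-filterᵇ p U)))))

  -- Walks through blobs, and return blobs that spare the chain

  module Walks {n : ℕ} (𝒯 : Tournament n) where
    open TournamentLists 𝒯
    open Paths 𝒯

    data Walk : List V → List (List V) → List V → Set where
      []  : ∀ {S} → Walk S [] S
      _∷_ : ∀ {S b bs R} → S ⇛ b → Walk b bs R → Walk S (b ∷ bs) R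

    walk-linked : ∀ {S bs R cs} → Walk S bs R → Linked _⇛_ (R ∷ cs) → Linked _⇛_ (S ∷ bs ++ cs)
    walk-linked []      l = l
    walk-linked (s ∷ w) l = s ∷ walk-linked w l

  module Touching {n : ℕ} (𝒯 : Tournament n) (k : ℕ) (P : List (List (Fin n)))
    (P-length : All (λ b → length b ≡ 2 * k) P) where
    open TournamentLists 𝒯
    open Membership {n}

    blobOf : List (List V) → V → List V
    blobOf []       v = []
    blobOf (b ∷ bs) v = if mem v b then b else blobOf bs v

    blobOf-length : ∀ bs v → All (λ b → length b ≡ 2 * k) bs → length (blobOf bs v) ≤ 2 * k
    blobOf-length []       v _ = z≤n
    blobOf-length (b ∷ bs) v (|b| ∷ |bs|) with mem v b
    ... | true  = ≤-reflexive |b|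
    ... | false = blobOf-length bs v |bs|

    blobOf-∈ : ∀ bs {v b} → AllPairs (λ b c → ∀ {v} → v ∈ b → v ∉ c) bs → b ∈ bs → v ∈ b → blobOf bs v ≡ b
    blobOf-∈ (b ∷ bs) {v} (dis ∷ d) (here refl) v∈ rewrite ∈⇒mem v∈ = refl
    blobOf-∈ (c ∷ bs) {v} (dis ∷ d) (there b∈)  v∈ with mem v c in eq
    ... | true  = contradiction v∈ (All.lookup dis b∈ (mem⇒∈ eq))
    ... | false = blobOf-∈ bs d b∈ v∈

    -- A return blob forbids its own `k` vertices and at most `k` chain blobs of size 2k.
    cost : ℕ
    cost = k + k * (2 * k)

    forbid : List V → List V → List V
    forbid F S = S ++ concatMap (blobOf P) S ++ F

    forbid-length : ∀ F S → length S ≡ k → length (forbid F S) ≤ length F + cost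
    forbid-length F S |S| = begin
      length (forbid F S)                                         ≡⟨ length-++ S ⟩
      length S + length (concatMap (blobOf P) S ++ F)
        ≡⟨ cong (length S +_) (length-++ (concatMap (blobOf P) S)) ⟩
      length S + (length (concatMap (blobOf P) S) + length F)
        ≤⟨ +-monoʳ-≤ (length S) (+-monoˡ-≤ (length F) (blobs S)) ⟩
      length S + (length S * (2 * k) + length F)                  ≡⟨ cong (λ s → s + (s * (2 * k) + length F)) |S| ⟩
      k + (k * (2 * k) + length F)                                ≡⟨ sym (+-assoc k _ _) ⟩
      cost + length F                                             ≡⟨ +-comm cost _ ⟩
      length F + cost ∎
      where
      open ≤-Reasoning
      blobs : ∀ S → length (concatMap (blobOf P) S) ≤ length S * (2 * k)
      blobs []      = z≤n
      blobs (v ∷ S) = ≤-trans (≤-reflexive (length-++ (blobOf P v))) (+-mono-≤ (blobOf-length P v P-length) (blobs S))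

    -- Each list in Qs also avoids every path blob met by an earlier one,
    -- so that a path blob is met by at most one list of Qs.
    Avoids : List V → List (List V) → Set
    Avoids F []       = ⊤
    Avoids F (Q ∷ Qs) = (∀ {v} → v ∈ Q → v ∉ F) × Avoids (forbid F Q) Qs

    avoids⇒∉ : ∀ {F} Qs → Avoids F Qs → ∀ {v} → v ∈ concat Qs → v ∉ F
    avoids⇒∉ (Q ∷ Qs) (a , as) v∈ v∈F with ∈-++⁻ Q v∈
    ... | inj₁ v∈Q  = a v∈Q v∈F
    ... | inj₂ v∈Qs = avoids⇒∉ Qs as v∈Qs (∈-++⁺ʳ Q (∈-++⁺ʳ (concatMap (blobOf P) Q) v∈F))

    avoids⇒unique : ∀ {F} Qs → All Transitive Qs → Avoids F Qs → Unique (concat Qs)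
    avoids⇒unique []       _          _        = []
    avoids⇒unique (Q ∷ Qs) (tr ∷ trs) (a , as) = Unique.++⁺ (transitive⇒unique tr) (avoids⇒unique Qs trs as)
      λ { (v∈Q , v∈Qs) → avoids⇒∉ Qs as v∈Qs (∈-++⁺ˡ v∈Q) }

    -- If `Q` is the first list to meet `b`, say in `w`, then disjointness of the chain blobs makes
    -- `b` the blob of `w`, which is forbidden to the rest of `Qs`. So `b` loses only vertices of
    -- `Q`, and there are `k` of those.
    avoids⇒few : ∀ {F} Qs {b} → AllPairs (λ b c → ∀ {v} → v ∈ b → v ∉ c) P → b ∈ P → Unique b →
      All (λ Q → length Q ≡ k) Qs → Avoids F Qs → count (λ v → mem v (concat Qs)) b ≤ k
    avoids⇒few []       {b} dis b∈ ub _ _ = ≤-trans (≤-reflexive (trans (sum-const b 0) (*-zeroʳ (length b)))) z≤n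
    avoids⇒few (Q ∷ Qs) {b} dis b∈ ub (|Q| ∷ |Qs|) (a , as) with Any.any? (λ v → v ∈? Q) b
      where open DecMembership (Fin._≟_ {n}) using (_∈?_)
    ... | no none = ≤-trans (count-mono b λ v∈b h → ∈⇒mem (later v∈b (∈-++⁻ Q (mem⇒∈ h)))) (avoids⇒few Qs dis b∈ ub |Qs| as)
      where
      later : ∀ {v} → v ∈ b → v ∈ Q ⊎ v ∈ concat Qs → v ∈ concat Qs
      later v∈b (inj₁ v∈Q)  = contradiction (lose v∈b v∈Q) none
      later v∈b (inj₂ v∈Qs) = v∈Qs
    ... | yes met with find met
    ...   | w , w∈b , w∈Q = ≤-trans (count-mono b λ v∈b h → ∈⇒mem (now v∈b (∈-++⁻ Q (mem⇒∈ h)))) (≤-trans (count-mem Q ub) (≤-reflexive |Q|))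
      where
      now : ∀ {v} → v ∈ b → v ∈ Q ⊎ v ∈ concat Qs → v ∈ Q
      now v∈b (inj₁ v∈Q)  = v∈Q
      now {v} v∈b (inj₂ v∈Qs) = contradiction
        (∈-++⁺ʳ Q (∈-++⁺ˡ (∈-concatMap⁺ (blobOf P) (Any.map (λ { refl → subst (v ∈_) (sym (blobOf-∈ P dis b∈ w∈b)) v∈b }) w∈Q))))
        (avoids⇒∉ Qs as v∈Qs)

  -- Layers of heavy vertices and the return path

  ≤ᵇ-elim : ∀ {a b} → (a ≤ᵇ b) ≡ true → a ≤ b
  ≤ᵇ-elim {a} {b} h = ≤ᵇ⇒≤ a b (Equivalence.from T-≡ h)

  ≤ᵇ-elim-not : ∀ {a b} → not (a ≤ᵇ b) ≡ true → b ≤ a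
  ≤ᵇ-elim-not {a} {b} h = <⇒≤ (≰⇒> λ le → absurd (trans (sym h) (cong not (Equivalence.to T-≡ (≤⇒≤ᵇ le)))))
    where
    absurd : true ≢ false
    absurd ()

  module Layers {n : ℕ} (𝒯 : Tournament n) (E : ℕ) where
    open TournamentLists 𝒯
    open Membership {n}
    open Orders 𝒯

    heavy : List V → (V → Bool) → V → Bool
    heavy U R v = count R U ≤ᵇ 2 * E * count (λ b → R b ∧ arc 𝒯 v b) U

    -- Density gives at least cr/E arcs from the c vertices outside `R` to the r vertices inside.
    -- Light vertices send at most r/2E arcs each, hence cr/2E in all; the remaining cr/2E arcs come
    -- from heavy vertices, each of which sends at most r.
    heavy-large : ∀ U R → CutDense E U → 1 ≤ count R U →
      count (not ∘ R) U ≤ 2 * E * count (λ v → not (R v) ∧ heavy U R v) U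
    heavy-large U R dense R≥1 = *-cancelʳ-≤ c (2 * E * h) r {{>-nonZero R≥1}} (+-cancelʳ-≤ (c * r) _ _ (begin
      c * r + c * r                                   ≡⟨ eq₁ c r ⟩
      2 * (c * r)                                     ≤⟨ *-monoʳ-≤ 2 cr≤ ⟩
      2 * (E * sumOf U (λ a → 𝟙 (not (R a)) * d a))   ≡⟨ sym (*-assoc 2 E _) ⟩
      2 * E * sumOf U (λ a → 𝟙 (not (R a)) * d a)     ≡⟨ sym (sum-*ˡ (2 * E) U _) ⟩
      sumOf U (λ a → 2 * E * (𝟙 (not (R a)) * d a))
        ≤⟨ sum-mono U (λ {a} _ → pointwise (not (R a)) (heavy U R a) (d a) (≤ᵇ-elim-not {r}) (d≤r a)) ⟩
      sumOf U (λ a → 2 * E * r * 𝟙 (not (R a) ∧ heavy U R a) + r * 𝟙 (not (R a)))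
        ≡⟨ trans (sum-+ U _ _) (cong₂ _+_ (sum-*ˡ (2 * E * r) U _) (sum-*ˡ r U _)) ⟩
      2 * E * r * h + r * c                           ≡⟨ eq₂ E r h c ⟩
      2 * E * h * r + c * r ∎))
      where
      open ≤-Reasoning
      c r h : ℕ
      c = count (not ∘ R) U
      r = count R U
      h = count (λ v → not (R v) ∧ heavy U R v) U
      d : V → ℕ
      d a = count (λ b → R b ∧ arc 𝒯 a b) U
      d≤r : ∀ a → d a ≤ r
      d≤r a = count-mono U λ _ → ∧-elimˡ
      pointwise : ∀ x y z → (not y ≡ true → 2 * E * z ≤ r) → z ≤ r → 2 * E * (𝟙 x * z) ≤ 2 * E * r * 𝟙 (x ∧ y) + r * 𝟙 x
      pointwise false y     z _ _ = ≤-trans (≤-reflexive (*-zeroʳ (2 * E))) z≤n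
      pointwise true  true  z _ z≤r = ≤-trans (*-monoʳ-≤ (2 * E) (≤-trans (≤-reflexive (+-identityʳ z)) z≤r))
                                     (≤-trans (≤-reflexive (sym (*-identityʳ _))) (m≤m+n _ _))
      pointwise true  false z light _ = ≤-trans (*-monoʳ-≤ (2 * E) (≤-reflexive (+-identityʳ z)))
                                     (≤-trans (light refl) (≤-trans (≤-reflexive (sym (*-identityʳ r))) (m≤n+m _ _)))
      cr≤ : c * r ≤ E * sumOf U (λ a → 𝟙 (not (R a)) * d a)
      cr≤ = go (1 ≤? c)
        where
        go : Dec (1 ≤ c) → c * r ≤ E * sumOf U (λ a → 𝟙 (not (R a)) * d a)
        -- Density says nothing about a cut with an empty side, but then the left side is zero.
        go (no c≱1) = ≤-trans (*-monoˡ-≤ r (s≤s⁻¹ (≰⇒> c≱1))) z≤n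
        go (yes c≥1) = <⇒≤ (subst₂ _<_ (cong (c *_) rr)
          (cong (E *_) (sum-cong U λ a → cong (𝟙 (not (R a)) *_) (count-cong U λ b → cong (_∧ arc 𝒯 a b) (not-involutive (R b)))))
          (dense (not ∘ R) c≥1 (≤-trans R≥1 (≤-reflexive (sym rr)))))
          where
          rr : count (not ∘ not ∘ R) U ≡ r
          rr = count-cong U (not-involutive ∘ R)
      eq₁ : ∀ c r → c * r + c * r ≡ 2 * (c * r)
      eq₁ = solve-∀
      eq₂ : ∀ E r h c → 2 * E * r * h + r * c ≡ 2 * E * h * r + c * r
      eq₂ = solve-∀

  module Powers (G : ℕ) (G≥16 : 16 ≤ G) where
    instance
      G≢0 : NonZero G
      G≢0 = >-nonZero (≤-trans (s≤s z≤n) G≥16)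

    G^-mono : ∀ {a b} → a ≤ b → G ^ a ≤ G ^ b
    G^-mono = ^-monoʳ-≤ G

    double : ∀ {a b c} → a ≤ c → b ≤ c → c < 20 → G ^ a + G ^ b ≤ G ^ suc c
    double {a} {b} {c} a≤c b≤c _ = begin
      G ^ a + G ^ b     ≤⟨ +-mono-≤ (G^-mono a≤c) (G^-mono b≤c) ⟩
      G ^ c + G ^ c     ≡⟨ cong (G ^ c +_) (sym (+-identityʳ (G ^ c))) ⟩
      2 * G ^ c         ≤⟨ *-monoˡ-≤ (G ^ c) (≤-trans (s≤s (s≤s z≤n)) G≥16) ⟩
      G ^ suc c ∎
      where open ≤-Reasoning

  module Connecting {n : ℕ} (𝒯 : Tournament n) (k D E G : ℕ) (4≤E : 4 ≤ E) (4E≤G : 4 * E ≤ G) (2E≤D : 2 * E ≤ D)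
    (k≤G : k ≤ G) (2^k≤G : 2 ^ k ≤ G) (G^20≤n : G ^ 20 ≤ n)
    (choose-k : TournamentLists.Choosable 𝒯 D G k)
    (P : List (List (Fin n))) (P-length : All (λ b → length b ≡ 2 * k) P)
    (S₀ : List (Fin n)) (Y : Fin n → Bool) (Y⟶S₀ : ∀ {v x} → Y v ≡ true → x ∈ S₀ → arc 𝒯 v x ≡ true)
    (U : List (Fin n)) (uU : Unique U) (dense : Orders.CutDense 𝒯 E U)
    where

    open TournamentLists 𝒯
    open Membership {n}
    open Orders 𝒯
    open Paths 𝒯
    open Layers 𝒯 E
    open Touching 𝒯 k P P-length
    open Powers G (≤-trans (*-monoʳ-≤ 4 4≤E) 4E≤G)

    Connectors : List V → List V → Set
    Connectors F S = ∃ λ Qs → Linked _⇛_ (S ∷ Qs ++ [ S₀ ]) × All Transitive Qs × All (λ Q → length Q ≡ k) Qs × Avoids F Qs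

    avoiding : List V → (V → Bool) → V → Bool
    avoiding F X v = X v ∧ not (mem v F)

    -- The threshold grows with i so that a set which is large in layer i + 1 either is large in layer i
    -- or has G vertices among those that are new in layer i + 1.
    Connectable : ℕ → (V → Bool) → Set
    Connectable i R = ∀ F (X : V → Bool) S → length F + (2 + i) * cost ≤ G ^ 8 →
      (1 + i) * G ≤ count (avoiding F (λ v → X v ∧ R v)) U →
      (∀ {x v} → x ∈ S → X v ≡ true → x ⟶ v) → Connectors F S

    -- One return blob inside `X`. Of the at least `G ^ 11` vertices of `Z`, at least `G ^ 10` are
    -- common out-neighbours of the blob; the enlarged forbidden list removes at most `G ^ 8` of
    -- them, so well over `G ^ 5` remain.
    advance : ∀ F X Z → length F + cost ≤ G ^ 8 → G ≤ count (avoiding F X) U →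
      (∀ {v} → X v ≡ true → count Z U ≤ 2 * E * count (λ b → Z b ∧ arc 𝒯 v b) U) → G ^ 11 ≤ count Z U →
      ∃ λ Q → length Q ≡ k × Transitive Q × (∀ {x} → x ∈ Q → X x ≡ true × x ∉ F) ×
        G ^ 5 ≤ count (avoiding (forbid F Q) (λ v → common (arc 𝒯) Q v ∧ Z v)) U
    advance F X Z F-small X-large degree Z-large = finish (choose-k (arc 𝒯) 𝒜 ℬ
      (≤-trans (m^n>0 G 11) (≤-trans Z-large (≤-reflexive (sym |ℬ|)))) (Unique.filter⁺ _ uU)
      (≤-trans X-large (≤-reflexive (sym (length-filterᵇ (avoiding F X) U)))) degree-D)
      where
      open ≤-Reasoning
      𝒜 ℬ : List V
      𝒜 = filterᵇ (avoiding F X) U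
      ℬ = filterᵇ Z U
      |ℬ| : length ℬ ≡ count Z U
      |ℬ| = length-filterᵇ Z U
      degree-D : ∀ {x} → x ∈ 𝒜 → length ℬ ≤ D * count (arc 𝒯 x) ℬ
      degree-D {x} x∈ = begin
        length ℬ                                   ≡⟨ |ℬ| ⟩
        count Z U                                  ≤⟨ degree (∧-elimˡ (proj₂ (∈-filterᵇ⁻ (avoiding F X) {xs = U} x∈))) ⟩
        2 * E * count (λ b → Z b ∧ arc 𝒯 x b) U   ≤⟨ *-monoˡ-≤ _ 2E≤D ⟩
        D * count (λ b → Z b ∧ arc 𝒯 x b) U       ≡⟨ cong (D *_) (sym (count-filter Z (arc 𝒯 x) U)) ⟩
        D * count (arc 𝒯 x) ℬ ∎
      finish : (∃ λ S → length S ≡ k × Transitive S × S ⊆ 𝒜 × length ℬ ≤ G * count (common (arc 𝒯) S) ℬ) →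
        ∃ λ Q → length Q ≡ k × Transitive Q × (∀ {x} → x ∈ Q → X x ≡ true × x ∉ F) ×
          G ^ 5 ≤ count (avoiding (forbid F Q) (λ v → common (arc 𝒯) Q v ∧ Z v)) U
      finish (Q , |Q| , tr , Q⊆A , many) = Q , |Q| , tr , Q-inside , remaining
        where
        Q-inside : ∀ {x} → x ∈ Q → X x ≡ true × x ∉ F
        Q-inside {x} x∈ = let h = proj₂ (∈-filterᵇ⁻ (avoiding F X) {xs = U} (Q⊆A x∈)) in ∧-elimˡ h , not-mem⇒∉ (∧-elimʳ {X x} h)
        c : ℕ
        c = count (λ v → common (arc 𝒯) Q v ∧ Z v) U
        c-large : G ^ 10 ≤ c
        c-large = *-cancelˡ-≤ G (begin
          G ^ 11                                      ≤⟨ Z-large ⟩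
          count Z U                                   ≡⟨ sym |ℬ| ⟩
          length ℬ                                    ≤⟨ many ⟩
          G * count (common (arc 𝒯) Q) ℬ              ≡⟨ cong (G *_) (count-filter Z (common (arc 𝒯) Q) U) ⟩
          G * count (λ v → Z v ∧ common (arc 𝒯) Q v) U
            ≤⟨ *-monoʳ-≤ G (count-mono U λ {v} _ h → ∧-intro (∧-elimʳ {Z v} h) (∧-elimˡ h)) ⟩
          G * c ∎)
        remaining : G ^ 5 ≤ count (avoiding (forbid F Q) (λ v → common (arc 𝒯) Q v ∧ Z v)) U
        remaining = +-cancelʳ-≤ (G ^ 8) _ _ (begin
          G ^ 5 + G ^ 8                               ≤⟨ double {5} {8} {8} (m≤m+n 5 3) ≤-refl (m≤m+n 9 11) ⟩
          G ^ 9                                       ≤⟨ G^-mono {9} {10} (m≤m+n 9 1) ⟩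
          G ^ 10                                      ≤⟨ c-large ⟩
          c                                           ≤⟨ count-avoid (λ v → common (arc 𝒯) Q v ∧ Z v) (forbid F Q) uU ⟩
          count (avoiding (forbid F Q) (λ v → common (arc 𝒯) Q v ∧ Z v)) U + length (forbid F Q)
                                                      ≤⟨ +-monoʳ-≤ _ (≤-trans (forbid-length F Q |Q|) F-small) ⟩
          count (avoiding (forbid F Q) (λ v → common (arc 𝒯) Q v ∧ Z v)) U + G ^ 8 ∎)

    common⇒⟶ : ∀ {Q x v} → x ∈ Q → common (arc 𝒯) Q v ≡ true → x ⟶ v
    common⇒⟶ {Q} {v = v} x∈ h = all-elim (λ a → arc 𝒯 a v) Q h x∈

    -- Two blobs suffice: `Q₁` among the vertices heavy towards `Y`, and `Q₂` among the common
    -- out-neighbours of `Q₁` in `Y`, where every vertex dominates `S₀`. For `Q₂` no further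
    -- neighbours are needed, so `ramsey` is enough.
    connectable-base : G ^ 11 ≤ count Y U → Connectable 0 (heavy U Y)
    connectable-base Y-large F X S F-small X-large S⟶X = Q₁ ∷ Q₂ ∷ [] ,
      (λ x∈ y∈ → S⟶X x∈ (∧-elimˡ (proj₁ (in₁ y∈)))) ∷
      (λ x∈ y∈ → common⇒⟶ x∈ (∧-elimˡ (∧-elimˡ (in₂ y∈)))) ∷
      (λ {x} x∈ y∈ → Y⟶S₀ (∧-elimʳ {common (arc 𝒯) Q₁ x} (∧-elimˡ (in₂ x∈))) y∈) ∷ [-] ,
      tr₁ ∷ tr₂ ∷ [] , |Q₁| ∷ |Q₂| ∷ [] ,
      (λ y∈ → proj₂ (in₁ y∈)) , (λ {v} y∈ → not-mem⇒∉ (∧-elimʳ {common (arc 𝒯) Q₁ v ∧ Y v} (in₂ y∈))) , tt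
      where
      open ≤-Reasoning
      first : ∃ λ Q → length Q ≡ k × Transitive Q × (∀ {x} → x ∈ Q → X x ∧ heavy U Y x ≡ true × x ∉ F) ×
        G ^ 5 ≤ count (avoiding (forbid F Q) (λ v → common (arc 𝒯) Q v ∧ Y v)) U
      first = advance F (λ v → X v ∧ heavy U Y v) Y
        (≤-trans (+-monoʳ-≤ (length F) (m≤m+n cost (1 * cost))) F-small)
        (≤-trans (≤-reflexive (sym (*-identityˡ G))) X-large)
        (λ {v} h → ≤ᵇ-elim (∧-elimʳ {X v} h)) Y-large
      Q₁ : List V
      Q₁ = proj₁ first
      |Q₁| : length Q₁ ≡ k
      |Q₁| = proj₁ (proj₂ first)
      tr₁ : Transitive Q₁
      tr₁ = proj₁ (proj₂ (proj₂ first))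
      in₁ : ∀ {x} → x ∈ Q₁ → X x ∧ heavy U Y x ≡ true × x ∉ F
      in₁ = proj₁ (proj₂ (proj₂ (proj₂ first)))
      target : V → Bool
      target = avoiding (forbid F Q₁) (λ v → common (arc 𝒯) Q₁ v ∧ Y v)
      second : ∃ λ S → length S ≡ k × Transitive S × S ⊆ filterᵇ target U
      second = ramsey k (Unique.filter⁺ _ uU) (begin
        2 ^ k          ≤⟨ 2^k≤G ⟩
        G              ≡⟨ sym (*-identityʳ G) ⟩
        G ^ 1          ≤⟨ G^-mono {1} {5} (m≤m+n 1 4) ⟩
        G ^ 5          ≤⟨ proj₂ (proj₂ (proj₂ (proj₂ first))) ⟩
        count target U ≡⟨ sym (length-filterᵇ target U) ⟩
        length (filterᵇ target U) ∎)
      Q₂ : List V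
      Q₂ = proj₁ second
      |Q₂| : length Q₂ ≡ k
      |Q₂| = proj₁ (proj₂ second)
      tr₂ : Transitive Q₂
      tr₂ = proj₁ (proj₂ (proj₂ second))
      in₂ : ∀ {x} → x ∈ Q₂ → target x ≡ true
      in₂ x∈ = proj₂ (∈-filterᵇ⁻ target {xs = U} (proj₂ (proj₂ (proj₂ second)) x∈))

    nextLayer : (V → Bool) → V → Bool
    nextLayer R v = R v ∨ heavy U R v

    -- When `X` has too few usable vertices in `R`, at least `G` of them are heavy towards `R`. A
    -- blob chosen there has `G ^ 5` usable common out-neighbours in `R`, which take over the part
    -- of `X`; they exceed the threshold because 1 + i ≤ G⁴. Each layer consumes one `cost` of the
    -- budget.
    connectable-step : ∀ i R → suc i ≤ G ^ 4 → G ^ 11 ≤ count R U → Connectable i R → Connectable (suc i) (nextLayer R)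
    connectable-step i R i-small R-large conn F X S F-small X-large S⟶X =
      go ((1 + i) * G ≤? count (avoiding F (λ v → X v ∧ R v)) U)
      where
      open ≤-Reasoning
      inR inH : V → Bool
      inR = avoiding F (λ v → X v ∧ R v)
      inH = avoiding F (λ v → X v ∧ heavy U R v)
      split : ∀ x r h f → 𝟙 ((x ∧ (r ∨ h)) ∧ f) ≤ 𝟙 ((x ∧ r) ∧ f) + 𝟙 ((x ∧ h) ∧ f)
      split false r     h f = z≤n
      split true  true  h f = m≤m+n (𝟙 f) _
      split true  false h f = ≤-refl
      go : Dec ((1 + i) * G ≤ count inR U) → Connectors F S
      go (yes R-many) = conn F X S
        (≤-trans (+-monoʳ-≤ (length F) (m≤n+m ((2 + i) * cost) cost)) F-small) R-many S⟶X
      go (no R-few) = extend (advance F (λ v → X v ∧ heavy U R v) R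
        (≤-trans (+-monoʳ-≤ (length F) (m≤m+n cost _)) F-small) H-many (λ {v} h → ≤ᵇ-elim (∧-elimʳ {X v} h)) R-large)
        where
        H-many : G ≤ count inH U
        H-many = +-cancelʳ-≤ ((1 + i) * G) _ _ (begin
          (2 + i) * G                             ≤⟨ X-large ⟩
          count (avoiding F (λ v → X v ∧ nextLayer R v)) U
            ≤⟨ sum-mono U (λ {v} _ → split (X v) (R v) (heavy U R v) (not (mem v F))) ⟩
          sumOf U (λ v → 𝟙 (inR v) + 𝟙 (inH v))   ≡⟨ sum-+ U _ _ ⟩
          count inR U + count inH U               ≤⟨ +-monoˡ-≤ _ (<⇒≤ (≰⇒> R-few)) ⟩
          (1 + i) * G + count inH U               ≡⟨ +-comm ((1 + i) * G) _ ⟩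
          count inH U + (1 + i) * G ∎)
        extend : (∃ λ Q → length Q ≡ k × Transitive Q × (∀ {x} → x ∈ Q → X x ∧ heavy U R x ≡ true × x ∉ F) ×
          G ^ 5 ≤ count (avoiding (forbid F Q) (λ v → common (arc 𝒯) Q v ∧ R v)) U) → Connectors F S
        extend (Q , |Q| , tr , inside , many) =
          let Qs , linked , trs , |Qs| , avoids = conn (forbid F Q) (common (arc 𝒯) Q) Q
                (begin
                  length (forbid F Q) + (2 + i) * cost     ≤⟨ +-monoˡ-≤ _ (forbid-length F Q |Q|) ⟩
                  length F + cost + (2 + i) * cost         ≡⟨ +-assoc (length F) cost _ ⟩
                  length F + (3 + i) * cost                ≤⟨ F-small ⟩
                  G ^ 8 ∎)
                (begin
                  (1 + i) * G                              ≤⟨ *-monoˡ-≤ G i-small ⟩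
                  G ^ 4 * G                                ≡⟨ *-comm (G ^ 4) G ⟩
                  G ^ 5                                    ≤⟨ many ⟩
                  count (avoiding (forbid F Q) (λ v → common (arc 𝒯) Q v ∧ R v)) U ∎)
                common⇒⟶
          in Q ∷ Qs , (λ x∈ y∈ → S⟶X x∈ (∧-elimˡ (proj₁ (inside y∈)))) ∷ linked , tr ∷ trs , |Q| ∷ |Qs| ,
             (λ y∈ → proj₂ (inside y∈)) , avoids

    -- Either `R` misses at most n/2G² vertices of `U`, or every round so far has added at least
    -- n/G³. The index `i` may be smaller than `j` because growth stops once the first alternative
    -- holds.
    Layer : ℕ → Set
    Layer j = ∃ λ i → ∃ λ R → i ≤ j × Connectable i R × G ^ 11 ≤ count R U ×
      (2 * G ^ 2 * count (not ∘ R) U ≤ n ⊎ j * n ≤ G ^ 3 * count R U)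

    4EG²≤G³ : ∀ h → 2 * G ^ 2 * (2 * E * h) ≤ G ^ 3 * h
    4EG²≤G³ h = begin
      2 * G ^ 2 * (2 * E * h)  ≡⟨ eq (G ^ 2) E h ⟩
      4 * E * G ^ 2 * h        ≤⟨ *-monoˡ-≤ h (*-monoˡ-≤ (G ^ 2) 4E≤G) ⟩
      G ^ 3 * h ∎
      where
      open ≤-Reasoning
      eq : ∀ g e h → 2 * g * (2 * e * h) ≡ 4 * e * g * h
      eq = solve-∀

    -- As `Y` fills at most half of `U`, its complement has at least |U|/2 vertices, and
    -- `heavy-large` makes the first layer at least |U|/4E however small `Y` is.
    layer-zero : G ^ 11 ≤ count Y U → 2 * count Y U ≤ length U → n ≤ G * length U → Layer 0
    layer-zero Y-large Y-half U-large =
      0 , heavy U Y , z≤n , connectable-base Y-large , ≤-trans (G^-mono {11} {17} (m≤m+n 11 6)) R-large , inj₂ z≤n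
      where
      open ≤-Reasoning
      c r : ℕ
      c = count (not ∘ Y) U
      r = count (heavy U Y) U
      c≤ : c ≤ 2 * E * r
      c≤ = ≤-trans (heavy-large U Y dense (≤-trans (m^n>0 G 11) Y-large))
                   (*-monoʳ-≤ (2 * E) (count-mono U λ {v} _ → ∧-elimʳ {not (Y v)}))
      U≤2c : length U ≤ 2 * c
      U≤2c = +-cancelˡ-≤ (length U) _ _ (begin
        length U + length U             ≡⟨ cong (length U +_) (sym (+-identityʳ _)) ⟩
        2 * length U                    ≡⟨ cong (2 *_) (count-not Y U) ⟩
        2 * (count Y U + c)             ≡⟨ *-distribˡ-+ 2 (count Y U) c ⟩
        2 * count Y U + 2 * c           ≤⟨ +-monoˡ-≤ (2 * c) Y-half ⟩
        length U + 2 * c ∎)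
      R-large : G ^ 17 ≤ r
      R-large = *-cancelˡ-≤ (G ^ 3) {{m^n≢0 G 3}} (begin
        G ^ 3 * G ^ 17                  ≡⟨ sym (^-distribˡ-+-* G 3 17) ⟩
        G ^ 20                          ≤⟨ G^20≤n ⟩
        n                               ≤⟨ U-large ⟩
        G * length U                    ≤⟨ *-monoʳ-≤ G (≤-trans U≤2c (*-monoʳ-≤ 2 c≤)) ⟩
        G * (2 * (2 * E * r))           ≡⟨ eq G (2 * E * r) ⟩
        2 * (G * 1) * (2 * E * r)       ≤⟨ *-monoˡ-≤ (2 * E * r) (*-monoʳ-≤ 2 (G^-mono {1} {2} (m≤m+n 1 1))) ⟩
        2 * G ^ 2 * (2 * E * r)         ≤⟨ 4EG²≤G³ r ⟩
        G ^ 3 * r ∎)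
        where
        eq : ∀ g x → g * (2 * x) ≡ 2 * (g * 1) * x
        eq = solve-∀

    -- If more than n/2G² vertices are missing, a fraction 1/2E of them is heavy, which is at least
    -- n/4EG² ≥ n/G³ new vertices.
    layer-suc : ∀ j → suc j ≤ G ^ 3 → Layer j → Layer (suc j)
    layer-suc j j< (i , R , i≤ , conn , R-large , inj₁ small) = i , R , m≤n⇒m≤1+n i≤ , conn , R-large , inj₁ small
    layer-suc j j< (i , R , i≤ , conn , R-large , inj₂ grown) = go (2 * G ^ 2 * count (not ∘ R) U ≤? n)
      where
      open ≤-Reasoning
      r h : ℕ
      r = count R U
      h = count (λ v → not (R v) ∧ heavy U R v) U
      next≡ : count (nextLayer R) U ≡ r + h
      next≡ = trans (sum-cong U λ v → 𝟙-∨ (R v) (heavy U R v)) (sum-+ U _ _)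
        where
        𝟙-∨ : ∀ a b → 𝟙 (a ∨ b) ≡ 𝟙 a + 𝟙 (not a ∧ b)
        𝟙-∨ true  b = refl
        𝟙-∨ false b = refl
      go : Dec (2 * G ^ 2 * count (not ∘ R) U ≤ n) → Layer (suc j)
      go (yes small) = i , R , m≤n⇒m≤1+n i≤ , conn , R-large , inj₁ small
      go (no  large) = suc i , nextLayer R , s≤s i≤ ,
        connectable-step i R (≤-trans (s≤s i≤) (≤-trans j< (G^-mono {3} {4} (m≤m+n 3 1)))) R-large conn ,
        ≤-trans R-large (≤-trans (m≤m+n r h) (≤-reflexive (sym next≡))) , inj₂ (begin
          n + j * n                          ≡⟨ +-comm n _ ⟩
          j * n + n                          ≤⟨ +-mono-≤ grown (<⇒≤ (≰⇒> large)) ⟩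
          G ^ 3 * r + 2 * G ^ 2 * count (not ∘ R) U
            ≤⟨ +-monoʳ-≤ (G ^ 3 * r) (*-monoʳ-≤ (2 * G ^ 2) (heavy-large U R dense (≤-trans (m^n>0 G 11) R-large))) ⟩
          G ^ 3 * r + 2 * G ^ 2 * (2 * E * h) ≤⟨ +-monoʳ-≤ (G ^ 3 * r) (4EG²≤G³ h) ⟩
          G ^ 3 * r + G ^ 3 * h              ≡⟨ sym (*-distribˡ-+ (G ^ 3) r h) ⟩
          G ^ 3 * (r + h)                    ≡⟨ cong (G ^ 3 *_) (sym next≡) ⟩
          G ^ 3 * count (nextLayer R) U ∎)

    layers : ∀ j → j ≤ G ^ 3 → Layer 0 → Layer j
    layers zero    _  l = l
    layers (suc j) j< l = layer-suc j j< (layers j (≤-trans (n≤1+n j) j<) l)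

    cost≤G³ : cost ≤ G ^ 3
    cost≤G³ = begin
      k + k * (2 * k)            ≤⟨ +-mono-≤ k≤G (*-mono-≤ k≤G (*-monoʳ-≤ 2 k≤G)) ⟩
      G + G * (2 * G)            ≤⟨ +-monoˡ-≤ (G * (2 * G)) (m≤m*n G G) ⟩
      G * G + G * (2 * G)        ≡⟨ eq G ⟩
      3 * (G ^ 2)                ≤⟨ *-monoˡ-≤ (G ^ 2) (≤-trans (m≤m+n 3 13) (≤-trans (*-monoʳ-≤ 4 4≤E) 4E≤G)) ⟩
      G ^ 3 ∎
      where
      open ≤-Reasoning
      eq : ∀ g → g * g + g * (2 * g) ≡ 3 * (g * (g * 1))
      eq = solve-∀

    2+G³≤G⁴ : 2 + G ^ 3 ≤ G ^ 4
    2+G³≤G⁴ = begin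
      2 + G ^ 3
        ≤⟨ +-monoˡ-≤ (G ^ 3) (≤-trans (m≤m+n 2 14) (≤-trans (≤-trans (*-monoʳ-≤ 4 4≤E) 4E≤G) (≤-reflexive (sym (*-identityʳ G))))) ⟩
      G ^ 1 + G ^ 3      ≤⟨ double {1} {3} {3} (m≤m+n 1 2) ≤-refl (m≤m+n 4 16) ⟩
      G ^ 4 ∎
      where open ≤-Reasoning

    -- After `G ^ 3` rounds at most n/2G² vertices of `U` are missed, half of what `X` is known to
    -- contain. So `X` meets the last layer in at least n/2G² vertices, far above the threshold (1 +
    -- i)G. The forbidden list starts empty: chain vertices are not excluded.
    connect : G ^ 11 ≤ count Y U → 2 * count Y U ≤ length U → n ≤ G * length U →
      ∀ X S → n ≤ G ^ 2 * count X U → (∀ {x v} → x ∈ S → X v ≡ true → x ⟶ v) → Connectors [] S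
    connect Y-large Y-half U-large X S X-large S⟶X = finish (layers (G ^ 3) ≤-refl (layer-zero Y-large Y-half U-large))
      where
      open ≤-Reasoning
      finish : Layer (G ^ 3) → Connectors [] S
      finish (i , R , i≤ , conn , _ , covered) = conn [] X S
        (begin
          (2 + i) * cost          ≤⟨ *-mono-≤ (≤-trans (+-monoʳ-≤ 2 i≤) 2+G³≤G⁴) cost≤G³ ⟩
          G ^ 4 * G ^ 3           ≡⟨ sym (^-distribˡ-+-* G 4 3) ⟩
          G ^ 7                   ≤⟨ G^-mono {7} {8} (m≤m+n 7 1) ⟩
          G ^ 8 ∎)
        (≤-trans many (count-mono U λ {v} _ h → ∧-intro h (∉⇒not-mem {v} {[]} (λ ())))) S⟶X
        where
        c m : ℕ
        c = count (not ∘ R) U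
        m = count (λ v → X v ∧ R v) U
        small : 2 * G ^ 2 * c ≤ n ⊎ G ^ 3 * n ≤ G ^ 3 * count R U → 2 * G ^ 2 * c ≤ n
        small (inj₁ s) = s
        -- `G ^ 3` rounds of growth give `R` at least `n` vertices in `U`, so nothing of `U` is
        -- missed.
        small (inj₂ l) = subst (λ z → 2 * G ^ 2 * z ≤ n) (sym c≡0) (≤-trans (≤-reflexive (*-zeroʳ (2 * G ^ 2))) z≤n)
          where
          c≡0 : c ≡ 0
          c≡0 = n≤0⇒n≡0 (+-cancelˡ-≤ (count R U) _ _ (begin
            count R U + c        ≡⟨ sym (count-not R U) ⟩
            length U             ≤⟨ unique-length≤n uU ⟩
            n                    ≤⟨ *-cancelˡ-≤ (G ^ 3) {{m^n≢0 G 3}} l ⟩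
            count R U            ≡⟨ sym (+-identityʳ _) ⟩
            count R U + 0 ∎))
        X≤ : count X U ≤ m + c
        X≤ = ≤-trans (≤-reflexive (count-∧-not X R U)) (+-monoʳ-≤ m (count-mono U λ {v} _ → ∧-elimʳ {X v}))
        n≤ : n ≤ 2 * G ^ 2 * m
        n≤ = +-cancelʳ-≤ n _ _ (begin
          n + n                             ≤⟨ +-mono-≤ X-large X-large ⟩
          G ^ 2 * count X U + G ^ 2 * count X U ≡⟨ eq (G ^ 2) (count X U) ⟩
          2 * G ^ 2 * count X U             ≤⟨ *-monoʳ-≤ (2 * G ^ 2) X≤ ⟩
          2 * G ^ 2 * (m + c)               ≡⟨ *-distribˡ-+ (2 * G ^ 2) m c ⟩
          2 * G ^ 2 * m + 2 * G ^ 2 * c     ≤⟨ +-monoʳ-≤ (2 * G ^ 2 * m) (small covered) ⟩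
          2 * G ^ 2 * m + n ∎)
          where
          eq : ∀ g x → g * x + g * x ≡ 2 * g * x
          eq = solve-∀
        many : (1 + i) * G ≤ m
        many = *-cancelˡ-≤ (2 * G ^ 2) {{m*n≢0 2 (G ^ 2) {{_}} {{m^n≢0 G 2}}}} (begin
          2 * G ^ 2 * ((1 + i) * G)
            ≤⟨ *-monoʳ-≤ (2 * G ^ 2) (*-monoˡ-≤ G (≤-trans (+-monoʳ-≤ 1 i≤) (≤-trans (n≤1+n _) 2+G³≤G⁴))) ⟩
          2 * G ^ 2 * (G ^ 4 * G)       ≡⟨ eq (G ^ 2) (G ^ 4 * G) ⟩
          2 * (G ^ 2 * (G ^ 4 * G))
            ≤⟨ *-monoˡ-≤ (G ^ 2 * (G ^ 4 * G)) (≤-trans (m≤m+n 2 14) (≤-trans (*-monoʳ-≤ 4 4≤E) 4E≤G)) ⟩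
          G * (G ^ 2 * (G ^ 4 * G))     ≡⟨ cong (λ z → G * (G ^ 2 * z)) (*-comm (G ^ 4) G) ⟩
          G * (G ^ 2 * G ^ 5)           ≡⟨ cong (G *_) (sym (^-distribˡ-+-* G 2 5)) ⟩
          G ^ 8                         ≤⟨ G^-mono {8} {20} (m≤m+n 8 12) ⟩
          G ^ 20                        ≤⟨ G^20≤n ⟩
          n                             ≤⟨ n≤ ⟩
          2 * G ^ 2 * m ∎)
          where
          eq : ∀ g x → 2 * g * x ≡ 2 * (g * x)
          eq = solve-∀

  -- The long chain inside K

  module LongPath {n : ℕ} (𝒯 : Tournament n) (s D E G : ℕ) (4E≤G : 4 * E ≤ G) (G≥16 : 16 ≤ G) (4E≤D : 4 * E ≤ D) (G^20≤n : G ^ 20 ≤ n)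
    (choose-s : TournamentLists.Choosable 𝒯 D G s)
    (K : List (Fin n)) (uK : Unique K) (degree : ∀ {v} → v ∈ K → n ≤ 2 * E * count (arc 𝒯 v) K)
    where

    open TournamentLists 𝒯
    open Membership {n}
    open Paths 𝒯
    open Walks 𝒯
    open Powers G G≥16

    outside : List V → (V → Bool) → V → Bool
    outside W X v = not (mem v W) ∧ X v

    large⇒G≤ : ∀ {c} → n ≤ G ^ 2 * c → G ≤ c
    large⇒G≤ {c} le = *-cancelˡ-≤ (G ^ 2) {{m^n≢0 G 2}} (begin
      G ^ 2 * G      ≡⟨ *-comm (G ^ 2) G ⟩
      G ^ 3          ≤⟨ G^-mono {3} {20} (m≤m+n 3 17) ⟩
      G ^ 20         ≤⟨ G^20≤n ⟩
      n              ≤⟨ le ⟩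
      G ^ 2 * c ∎)
      where open ≤-Reasoning

    -- While `W` has at most n/4E vertices, every vertex of K keeps at least n/4E out-neighbours
    -- outside `W`. Taking all of K outside `W` as target gives n/4EG ≥ n/G² common out-neighbours
    -- whatever the size of `X`, so the hypothesis on `X` is restored in full for the next blob.
    extend : ∀ W X → 4 * E * length W ≤ n → n ≤ G ^ 2 * count (outside W X) K →
      ∃ λ S → length S ≡ s × Transitive S × (∀ {x} → x ∈ S → X x ≡ true × x ∉ W) ×
        n ≤ G ^ 2 * count (outside (S ++ W) (common (arc 𝒯) S)) K
    extend W X W-small X-large = finish (choose-s (arc 𝒯) 𝒜 ℬ (≤-trans |𝒜|≥1 |𝒜|≤|ℬ|) (Unique.filter⁺ _ uK) |𝒜|≥G
      (λ x∈ → ≤-trans |ℬ|≤n (≤-trans (degree-B x∈) (*-monoˡ-≤ _ 4E≤D))))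
      where
      open ≤-Reasoning
      𝒜 ℬ : List V
      𝒜 = filterᵇ (outside W X) K
      ℬ = filterᵇ (λ v → not (mem v W)) K
      |𝒜|≥G : G ≤ length 𝒜
      |𝒜|≥G = ≤-trans (large⇒G≤ X-large) (≤-reflexive (sym (length-filterᵇ (outside W X) K)))
      |𝒜|≤|ℬ| : length 𝒜 ≤ length ℬ
      |𝒜|≤|ℬ| = subst₂ _≤_ (sym (length-filterᵇ (outside W X) K)) (sym (length-filterᵇ (λ v → not (mem v W)) K))
        (count-mono K λ _ → ∧-elimˡ)
      |𝒜|≥1 : 1 ≤ length 𝒜
      |𝒜|≥1 = ≤-trans (≤-trans (m≤m+n 1 15) G≥16) |𝒜|≥G
      |ℬ|≤n : length ℬ ≤ n
      |ℬ|≤n = unique-length≤n (Unique.filter⁺ _ uK)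
      degree-B : ∀ {x} → x ∈ 𝒜 → n ≤ 4 * E * count (arc 𝒯 x) ℬ
      degree-B {x} x∈ = +-cancelʳ-≤ n _ _ (begin
        n + n                                     ≤⟨ +-mono-≤ deg deg ⟩
        2 * E * d + 2 * E * d                     ≡⟨ eq E d ⟩
        4 * E * d                                 ≤⟨ *-monoʳ-≤ (4 * E) d≤ ⟩
        4 * E * (count (arc 𝒯 x) ℬ + length W)   ≡⟨ *-distribˡ-+ (4 * E) (count (arc 𝒯 x) ℬ) (length W) ⟩
        4 * E * count (arc 𝒯 x) ℬ + 4 * E * length W ≤⟨ +-monoʳ-≤ (4 * E * count (arc 𝒯 x) ℬ) W-small ⟩
        4 * E * count (arc 𝒯 x) ℬ + n ∎)
        where
        d : ℕ
        d = count (arc 𝒯 x) K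
        deg : n ≤ 2 * E * d
        deg = degree (proj₁ (∈-filterᵇ⁻ (outside W X) x∈))
        d≤ : d ≤ count (arc 𝒯 x) ℬ + length W
        d≤ = ≤-trans (count-avoid (arc 𝒯 x) W uK) (+-monoˡ-≤ (length W) (≤-trans
          (count-mono K λ {v} _ h → ∧-intro (∧-elimʳ {arc 𝒯 x v} h) (∧-elimˡ h))
          (≤-reflexive (sym (count-filter (λ v → not (mem v W)) (arc 𝒯 x) K)))))
        eq : ∀ e d → 2 * e * d + 2 * e * d ≡ 4 * e * d
        eq = solve-∀
      n≤4Eℬ : n ≤ 4 * E * length ℬ
      n≤4Eℬ = let x , x∈ = length≥1⇒∈ |𝒜|≥1 in ≤-trans (degree-B x∈) (*-monoʳ-≤ (4 * E) (count≤length (arc 𝒯 x) ℬ))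
      finish : (∃ λ S → length S ≡ s × Transitive S × S ⊆ 𝒜 × length ℬ ≤ G * count (common (arc 𝒯) S) ℬ) →
        ∃ λ S → length S ≡ s × Transitive S × (∀ {x} → x ∈ S → X x ≡ true × x ∉ W) ×
          n ≤ G ^ 2 * count (outside (S ++ W) (common (arc 𝒯) S)) K
      finish (S , |S| , tr , S⊆A , many) = S , |S| , tr , S-inside , remaining
        where
        S-inside : ∀ {x} → x ∈ S → X x ≡ true × x ∉ W
        S-inside {x} x∈ = let h = proj₂ (∈-filterᵇ⁻ (outside W X) {xs = K} (S⊆A x∈)) in
          ∧-elimʳ {not (mem x W)} h , not-mem⇒∉ (∧-elimˡ h)
        -- A common out-neighbour of `S` is not in `S`, as there are no loops; so enlarging `W` by
        -- `S` costs nothing here.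
        common-outside : ∀ {v} → not (mem v W) ∧ common (arc 𝒯) S v ≡ true → outside (S ++ W) (common (arc 𝒯) S) v ≡ true
        common-outside {v} h = ∧-intro (∉⇒not-mem {v} {S ++ W} v∉) com
          where
          com : common (arc 𝒯) S v ≡ true
          com = ∧-elimʳ {not (mem v W)} h
          v∉ : v ∉ S ++ W
          v∉ v∈ = [ (λ v∈S → ⟶⇒≢ (all-elim (λ a → arc 𝒯 a v) S com v∈S) refl) , not-mem⇒∉ {v} {W} (∧-elimˡ h) ]′ (∈-++⁻ S v∈)
        remaining : n ≤ G ^ 2 * count (outside (S ++ W) (common (arc 𝒯) S)) K
        remaining = begin
          n                                                ≤⟨ n≤4Eℬ ⟩
          4 * E * length ℬ                                 ≤⟨ *-mono-≤ 4E≤G (many) ⟩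
          G * (G * count (common (arc 𝒯) S) ℬ)
            ≡⟨ cong (λ z → G * (G * z)) (count-filter (λ v → not (mem v W)) (common (arc 𝒯) S) K) ⟩
          G * (G * count (λ v → not (mem v W) ∧ common (arc 𝒯) S v) K)
            ≤⟨ *-monoʳ-≤ G (*-monoʳ-≤ G (count-mono {p = λ v → not (mem v W) ∧ common (arc 𝒯) S v} {q = outside (S ++ W) (common (arc 𝒯) S)} K λ {v} _ → common-outside {v})) ⟩
          G * (G * count (outside (S ++ W) (common (arc 𝒯) S)) K)                                      ≡⟨ eq G _ ⟩
          G ^ 2 * count (outside (S ++ W) (common (arc 𝒯) S)) K ∎
          where
          eq : ∀ g c → g * (g * c) ≡ g * (g * 1) * c
          eq = solve-∀

    record PathFrom (W S : List V) (t : ℕ) : Set where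
      field
        bs           : List (List V)
        end          : List V
        X            : V → Bool
        walk         : Walk S bs end
        transitive   : All Transitive bs
        lengths      : All (λ b → length b ≡ s) bs
        |bs|         : length bs ≡ t
        unique       : Unique (concat bs)
        avoids       : ∀ {v} → v ∈ concat bs → v ∉ W
        end⟶X        : ∀ {x v} → x ∈ end → X v ≡ true → x ⟶ v
        X-large      : n ≤ G ^ 2 * count X K

    longPath : ∀ t W S X → 4 * E * (length W + t * s) ≤ n → n ≤ G ^ 2 * count (outside W X) K →
      (∀ {x v} → x ∈ S → X v ≡ true → x ⟶ v) → PathFrom W S t
    longPath zero W S X W-small X-large S⟶X = record
      { bs = [] ; end = S ; X = X ; walk = [] ; transitive = [] ; lengths = [] ; |bs| = refl ; unique = []
      ; avoids = λ () ; end⟶X = S⟶X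
      ; X-large = ≤-trans X-large (*-monoʳ-≤ (G ^ 2) (count-mono K λ {v} _ → ∧-elimʳ {not (mem v W)})) }
    longPath (suc t) W S X W-small X-large S⟶X = prepend
      (extend W X (≤-trans (*-monoʳ-≤ (4 * E) (m≤m+n (length W) _)) W-small) X-large)
      where
      prepend : (∃ λ S → length S ≡ s × Transitive S × (∀ {x} → x ∈ S → X x ≡ true × x ∉ W) ×
        n ≤ G ^ 2 * count (outside (S ++ W) (common (arc 𝒯) S)) K) → PathFrom W S (suc t)
      prepend (S′ , |S′| , tr , inside , large) = record
        { bs = S′ ∷ bs ; end = end ; X = X′
        ; walk = (λ x∈ y∈ → S⟶X x∈ (proj₁ (inside y∈))) ∷ walk
        ; transitive = tr ∷ transitive ; lengths = |S′| ∷ lengths ; |bs| = cong suc |bs|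
        ; unique = Unique.++⁺ (transitive⇒unique tr) unique λ { (v∈S′ , v∈bs) → avoids v∈bs (∈-++⁺ˡ v∈S′) }
        ; avoids = λ v∈ v∈W → [ (λ v∈S′ → proj₂ (inside v∈S′) v∈W) , (λ v∈bs → avoids v∈bs (∈-++⁺ʳ S′ v∈W)) ]′ (∈-++⁻ S′ v∈)
        ; end⟶X = end⟶X ; X-large = X′-large }
        where
        W′-small : 4 * E * (length (S′ ++ W) + t * s) ≤ n
        W′-small = ≤-trans (≤-reflexive (cong (4 * E *_) (trans (cong (_+ t * s) (trans (length-++ S′) (cong (_+ length W) |S′|)))
          (eq s (length W) (t * s))))) W-small
          where
          eq : ∀ a w b → a + w + b ≡ w + (a + b)
          eq = solve-∀
        open PathFrom (longPath t (S′ ++ W) S′ (common (arc 𝒯) S′) W′-small large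
          (λ {x} {v} x∈ h → all-elim (λ a → arc 𝒯 a v) S′ h x∈)) renaming (X to X′; X-large to X′-large)

  -- The starting blob

  module Start {n : ℕ} (𝒯 : Tournament n) (s D E G : ℕ) (2E≤G : 2 * E ≤ G) (G≥16 : 16 ≤ G) (2EE≤D : 2 * E * E ≤ D) (G^20≤n : G ^ 20 ≤ n)
    (choose-s : TournamentLists.Choosable 𝒯 D G s)
    (core : Orders.Core 𝒯 E)
    where

    open TournamentLists 𝒯
    open Membership {n}
    open Orders 𝒯
    open Core core
    open Powers G G≥16

    n≤G|K| : n ≤ G * length K
    n≤G|K| = let v , v∈ = length≥1⇒∈ K≥1 in
      ≤-trans (K-degree v∈) (*-mono-≤ 2E≤G (count≤length (arc 𝒯 v) K))

    K-large : G ^ 19 ≤ length K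
    K-large = *-cancelˡ-≤ G (≤-trans G^20≤n n≤G|K|)

    |K|≤|U| : length K ≤ length U
    |K|≤|U| = unique-⊆⇒length≤ K-unique K⊆U

    -- Density of the cut that separates `v` from the rest: the arcs across it are the arcs into
    -- `v`.
    inDegree : ∀ {v} → v ∈ U → length U ≤ E * count (λ u → arc 𝒯 u v) U
    inDegree {v} v∈ = begin
      length U                          ≡⟨ count-not q U ⟩
      count q U + count p U             ≤⟨ +-monoˡ-≤ _ q≤1 ⟩
      1 + count p U                     ≡⟨ cong suc (sym (*-identityʳ _)) ⟩
      1 + count p U * 1                 ≤⟨ s≤s (*-monoʳ-≤ (count p U) ¬p≥1) ⟩
      1 + count p U * count (not ∘ p) U ≤⟨ U-dense p p≥1 ¬p≥1 ⟩
      E * arcsAcross p U                ≤⟨ *-monoʳ-≤ E (sum-mono U λ {a} _ → across a) ⟩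
      E * count (λ u → arc 𝒯 u v) U ∎
      where
      open ≤-Reasoning
      q p : V → Bool
      q u = does (u Fin.≟ v)
      p u = not (q u)
      q≤1 : count q U ≤ 1
      q≤1 = count-≟ v U-unique
      ¬p≡q : count (not ∘ p) U ≡ count q U
      ¬p≡q = count-cong U (not-involutive ∘ q)
      ¬p≥1 : 1 ≤ count (not ∘ p) U
      ¬p≥1 = ≤-trans (∈⇒count≥1 q v∈ (dec-true (v Fin.≟ v) refl)) (≤-reflexive (sym ¬p≡q))
      p≥1 : 1 ≤ count p U
      p≥1 = +-cancelˡ-≤ 1 _ _ (begin
        2                      ≤⟨ ≤-trans (m≤m+n 2 14) G≥16 ⟩
        G                      ≡⟨ sym (*-identityʳ G) ⟩
        G ^ 1                  ≤⟨ G^-mono {1} {19} (m≤m+n 1 18) ⟩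
        G ^ 19                 ≤⟨ K-large ⟩
        length K               ≤⟨ |K|≤|U| ⟩
        length U               ≡⟨ count-not q U ⟩
        count q U + count p U  ≤⟨ +-monoˡ-≤ _ q≤1 ⟩
        1 + count p U ∎)
      bounded : ∀ a x → arc 𝒯 a v ≡ x → count (λ b → not (p b) ∧ arc 𝒯 a b) U ≤ 𝟙 x
      bounded a true  _ = ≤-trans (count-mono U λ {b} _ → ∧-elimˡ) (≤-trans (≤-reflexive ¬p≡q) q≤1)
      bounded a false a↛v = ≤-trans (count-mono {q = λ _ → false} U λ {b} _ h → none b (b Fin.≟ v) h) (≤-reflexive (trans (sum-const U 0) (*-zeroʳ (length U))))
        where
        none : ∀ b (d : Dec (b ≡ v)) → not (not (does d)) ∧ arc 𝒯 a b ≡ true → false ≡ true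
        none b (yes refl) h = trans (sym a↛v) h
        none b (no _)     h = h
      across : ∀ a → 𝟙 (p a) * count (λ b → not (p b) ∧ arc 𝒯 a b) U ≤ 𝟙 (arc 𝒯 a v)
      across a = ≤-trans (*-monoˡ-≤ _ (𝟙≤1 (p a))) (≤-trans (≤-reflexive (+-identityʳ _)) (bounded a (arc 𝒯 a v) refl))

    Sources Sinks : List V → V → Bool
    Sources S u = all (λ a → arc 𝒯 u a) S
    Sinks   S w = all (λ a → arc 𝒯 a w) S

    -- Dependent random choice against pairs controls in- and out-neighbourhoods at the same time.
    startBlob : ∃ λ S → length S ≡ s × Transitive S × n ≤ G ^ 2 * count (Sources S) U × n ≤ G ^ 2 * count (Sinks S) K
    startBlob = finish (choose-s r K ℬ |ℬ|≥1 K-unique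
      (≤-trans (≤-reflexive (sym (*-identityʳ G))) (≤-trans (G^-mono {1} {19} (m≤m+n 1 18)) K-large)) degrees)
      where
      open ≤-Reasoning
      ℬ : List (V × V)
      ℬ = cartesianProduct U K
      r : V → V × V → Bool
      r a (u , w) = arc 𝒯 u a ∧ arc 𝒯 a w
      |ℬ| : length ℬ ≡ length U * length K
      |ℬ| = length-cartesianProductWith _,_ U K
      |ℬ|≥1 : 1 ≤ length ℬ
      |ℬ|≥1 = ≤-trans (*-mono-≤ (≤-trans K≥1 |K|≤|U|) K≥1) (≤-reflexive (sym |ℬ|))
      count-product : ∀ (f g : V → Bool) → count (λ { (u , w) → f u ∧ g w }) ℬ ≡ count f U * count g K
      count-product f g = trans (sum-cartesianProduct U K _) (trans
        (sum-cong U λ u → trans (sum-cong K λ w → 𝟙-∧ (f u) (g w)) (sum-*ˡ (𝟙 (f u)) K _))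
        (sum-*ʳ (count g K) U _))
      degrees : ∀ {a} → a ∈ K → length ℬ ≤ D * count (r a) ℬ
      degrees {a} a∈ = begin
        length ℬ                                  ≡⟨ |ℬ| ⟩
        length U * length K
          ≤⟨ *-mono-≤ (inDegree (K⊆U a∈)) (≤-trans (unique-length≤n K-unique) (K-degree a∈)) ⟩
        E * din * (2 * E * dout)                  ≡⟨ eq E din dout ⟩
        2 * E * E * (din * dout)                  ≤⟨ *-monoˡ-≤ (din * dout) 2EE≤D ⟩
        D * (din * dout)                          ≡⟨ cong (D *_) (sym (count-product (λ u → arc 𝒯 u a) (arc 𝒯 a))) ⟩
        D * count (r a) ℬ ∎
        where
        din dout : ℕ
        din  = count (λ u → arc 𝒯 u a) U
        dout = count (arc 𝒯 a) K
        eq : ∀ e x y → e * x * (2 * e * y) ≡ 2 * e * e * (x * y)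
        eq = solve-∀
      finish : (∃ λ S → length S ≡ s × Transitive S × S ⊆ K × length ℬ ≤ G * count (common r S) ℬ) →
        ∃ λ S → length S ≡ s × Transitive S × n ≤ G ^ 2 * count (Sources S) U × n ≤ G ^ 2 * count (Sinks S) K
      finish (S , |S| , tr , S⊆K , many) = S , |S| , tr ,
        square (≤-trans n≤G|K| (*-monoʳ-≤ G |K|≤|U|)) sources , square n≤G|K| sinks
        where
        -- A lower bound on the product suffices: bounding one factor trivially by |K| or |U| leaves
        -- the other with at least a 1/G share of its set.
        product≤ : length U * length K ≤ G * (count (Sources S) U * count (Sinks S) K)
        product≤ = begin
          length U * length K       ≡⟨ sym |ℬ| ⟩
          length ℬ                  ≤⟨ many ⟩
          G * count (common r S) ℬ
            ≤⟨ *-monoʳ-≤ G (≤-trans (count-mono ℬ λ {b} _ → both b) (≤-reflexive (count-product (Sources S) (Sinks S)))) ⟩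
          G * (count (Sources S) U * count (Sinks S) K) ∎
          where
          both : ∀ b → common r S b ≡ true → Sources S (proj₁ b) ∧ Sinks S (proj₂ b) ≡ true
          both (u , w) h = ∧-intro (all-intro _ S λ a∈ → ∧-elimˡ (all-elim _ S h a∈))
                                   (all-intro _ S λ {a} a∈ → ∧-elimʳ {arc 𝒯 u a} (all-elim _ S h a∈))
        sources : length U ≤ G * count (Sources S) U
        sources = *-cancelʳ-≤ _ _ (length K) {{>-nonZero K≥1}} (begin
          length U * length K                              ≤⟨ product≤ ⟩
          G * (count (Sources S) U * count (Sinks S) K)
            ≤⟨ *-monoʳ-≤ G (*-monoʳ-≤ (count (Sources S) U) (count≤length (Sinks S) K)) ⟩
          G * (count (Sources S) U * length K)             ≡⟨ sym (*-assoc G _ _) ⟩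
          G * count (Sources S) U * length K ∎)
        sinks : length K ≤ G * count (Sinks S) K
        sinks = *-cancelˡ-≤ (length U) {{>-nonZero (≤-trans K≥1 |K|≤|U|)}} (begin
          length U * length K                              ≤⟨ product≤ ⟩
          G * (count (Sources S) U * count (Sinks S) K)
            ≤⟨ *-monoʳ-≤ G (*-monoˡ-≤ (count (Sinks S) K) (count≤length (Sources S) U)) ⟩
          G * (length U * count (Sinks S) K)               ≡⟨ eq G (length U) (count (Sinks S) K) ⟩
          length U * (G * count (Sinks S) K) ∎)
          where
          eq : ∀ g u c → g * (u * c) ≡ u * (g * c)
          eq = solve-∀
        square : ∀ {l c} → n ≤ G * l → l ≤ G * c → n ≤ G ^ 2 * c
        square {l} {c} n≤ l≤ = ≤-trans n≤ (≤-trans (*-monoʳ-≤ G l≤) (≤-reflexive (eq G c)))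
          where
          eq : ∀ g c → g * (g * c) ≡ g * (g * 1) * c
          eq = solve-∀

  -- Assembling chain and return path into a cycle power

  concat-filter : ∀ {A : Set} (p : A → Bool) bs → concat (map (filterᵇ p) bs) ≡ filterᵇ p (concat bs)
  concat-filter p []       = refl
  concat-filter p (b ∷ bs) = trans (cong (filterᵇ p b ++_) (concat-filter p bs)) (sym (filter-++ (T? ∘ p) b (concat bs)))

  unique-concat⇒disjoint : ∀ {A : Set} (bs : List (List A)) → Unique (concat bs) → AllPairs (λ b c → ∀ {v} → v ∈ b → v ∉ c) bs
  unique-concat⇒disjoint []       _ = []
  unique-concat⇒disjoint (b ∷ bs) u =
    All.tabulate (λ c∈ v∈b v∈c → disjoint b u v∈b (∈-concat⁺′ v∈c c∈)) ∷ unique-concat⇒disjoint bs (unique-++ʳ b u)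
    where
    disjoint : ∀ {A : Set} (xs : List A) {ys} → Unique (xs ++ ys) → ∀ {v} → v ∈ xs → v ∉ ys
    disjoint (x ∷ xs) (x∉ ∷ u) (here refl) v∈ys = All.lookup x∉ (∈-++⁺ʳ xs v∈ys) refl
    disjoint (x ∷ xs) (x∉ ∷ u) (there v∈)  v∈ys = disjoint xs u v∈ v∈ys
    unique-++ʳ : ∀ {A : Set} (xs : List A) {ys} → Unique (xs ++ ys) → Unique ys
    unique-++ʳ []       u       = u
    unique-++ʳ (x ∷ xs) (_ ∷ u) = unique-++ʳ xs u

  length-concat≥ : ∀ {A : Set} k (bs : List (List A)) → All (λ b → k ≤ length b) bs → length bs * k ≤ length (concat bs)
  length-concat≥ k []       _        = z≤n
  length-concat≥ k (b ∷ bs) (h ∷ hs) = ≤-trans (+-mono-≤ h (length-concat≥ k bs hs)) (≤-reflexive (sym (length-++ b)))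

  module Assembly {n : ℕ} (𝒯 : Tournament n) (k D E G : ℕ) (4≤E : 4 ≤ E) (1≤k : 1 ≤ k) (4E≤G : 4 * E ≤ G)
    (4E≤D : 4 * E ≤ D) (2EE≤D : 2 * E * E ≤ D) (k≤G : k ≤ G) (2^k≤G : 2 ^ k ≤ G) (G^20≤n : G ^ 20 ≤ n)
    (choose-k : TournamentLists.Choosable 𝒯 D G k)
    (choose-2k : TournamentLists.Choosable 𝒯 D G (2 * k))
    (core : Orders.Core 𝒯 E)
    where

    open TournamentLists 𝒯
    open Membership {n}
    open Paths 𝒯
    open Walks 𝒯
    open Orders.Core core

    2E≤4E : 2 * E ≤ 4 * E
    2E≤4E = *-monoˡ-≤ E (m≤m+n 2 2)

    G≥16 : 16 ≤ G
    G≥16 = ≤-trans (*-monoʳ-≤ 4 4≤E) 4E≤G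

    open Powers G G≥16
    module 𝒮 = Start 𝒯 (2 * k) D E G (≤-trans 2E≤4E 4E≤G) G≥16 2EE≤D G^20≤n choose-2k core
    module ℒ = LongPath 𝒯 (2 * k) D E G 4E≤G G≥16 4E≤D G^20≤n choose-2k K K-unique K-degree

    -- The budget condition of `longPath` charges 4E per vertex, hence 8Ek for a blob of size 2k.
    N : ℕ
    N = 8 * E * k

    -- `suc t` is ⌊n/N⌋ and counts `S₀` as well; since it is at least 1, rounding down loses at most
    -- a factor 2.
    blobNumber : ∃ λ t → N * suc t ≤ n × n ≤ 2 * (N * suc t)
    blobNumber = go (n / N) (m/n*n≤m n N) upper
      where
      open ≤-Reasoning
      instance
        N≢0 : NonZero N
        N≢0 = >-nonZero (*-mono-≤ {1} {8 * E} {1} {k} (*-mono-≤ {1} {8} {1} {E} (m≤m+n 1 7) (≤-trans (m≤m+n 1 3) 4≤E)) 1≤k)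
      upper : n ≤ N + n / N * N
      upper = ≤-trans (≤-reflexive (m≡m%n+[m/n]*n n N)) (+-monoˡ-≤ (n / N * N) (<⇒≤ (m%n<n n N)))
      N<n : N < n
      N<n = begin-strict
        8 * E * k           ≡⟨ cong (_* k) (*-assoc 2 4 E) ⟩
        2 * (4 * E) * k     ≤⟨ *-mono-≤ (*-monoʳ-≤ 2 4E≤G) k≤G ⟩
        2 * G * G           ≡⟨ eq G ⟩
        2 * G ^ 2           ≤⟨ *-monoˡ-≤ (G ^ 2) (≤-trans (m≤m+n 2 14) G≥16) ⟩
        G ^ 3               <⟨ ^-monoʳ-< G (≤-trans (m≤m+n 2 14) G≥16) {3} {20} (m≤m+n 4 16) ⟩
        G ^ 20              ≤⟨ G^20≤n ⟩
        n ∎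
        where
        eq : ∀ g → 2 * g * g ≡ 2 * (g * (g * 1))
        eq = solve-∀
      go : ∀ q → q * N ≤ n → n ≤ N + q * N → ∃ λ t → N * suc t ≤ n × n ≤ 2 * (N * suc t)
      go zero    lo hi = contradiction (≤-trans hi (≤-reflexive (+-identityʳ N))) (<⇒≱ N<n)
      go (suc t) lo hi = t , ≤-trans (≤-reflexive (*-comm N (suc t))) lo , (begin
        n                          ≤⟨ hi ⟩
        N + suc t * N              ≤⟨ +-monoˡ-≤ _ (m≤m+n N (t * N)) ⟩
        suc t * N + suc t * N      ≡⟨ eq t N ⟩
        2 * (N * suc t) ∎)
        where
        eq : ∀ t x → suc t * x + suc t * x ≡ 2 * (x * suc t)
        eq = solve-∀

    linked-shrink : ∀ {bs cs} → Pointwise _⊆_ bs cs → Linked _⇛_ cs → Linked _⇛_ bs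
    linked-shrink []            []       = []
    linked-shrink (s ∷ [])      [-]      = [-]
    linked-shrink (s ∷ s′ ∷ ss) (l ∷ ls) = (λ x∈ y∈ → l (s x∈) (s′ y∈)) ∷ linked-shrink (s′ ∷ ss) ls

    module Closing (t : ℕ) (S₀ : List V) (|S₀| : length S₀ ≡ 2 * k) (tr₀ : Transitive S₀)
      (path : ℒ.PathFrom S₀ S₀ t) where
      open ℒ.PathFrom path

      P : List (List V)
      P = S₀ ∷ bs

      P-length : All (λ b → length b ≡ 2 * k) P
      P-length = |S₀| ∷ lengths

      P-transitive : All Transitive P
      P-transitive = tr₀ ∷ transitive

      P-unique : Unique (concat P)
      P-unique = Unique.++⁺ (transitive⇒unique tr₀) unique λ { (v∈S₀ , v∈bs) → avoids v∈bs v∈S₀ }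

      open Touching 𝒯 k P P-length

      module Pruned (Qs : List (List V)) (linked : Linked _⇛_ (end ∷ Qs ++ [ S₀ ])) (trQ : All Transitive Qs)
        (|Q| : All (λ Q → length Q ≡ k) Qs) (avoidsQ : Avoids [] Qs) where

        unused : V → Bool
        unused v = not (mem v (concat Qs))

        prune : List V → List V
        prune = filterᵇ unused

        prune-blob : ∀ {b} → b ∈ P → Blob k (prune b)
        prune-blob {b} b∈ = AllPairs.filter⁺ (T? ∘ unused) (All.lookup P-transitive b∈) , +-cancelˡ-≤ k _ _ (begin
          k + k                                             ≡⟨ cong (k +_) (sym (+-identityʳ k)) ⟩
          2 * k                                             ≡⟨ sym (All.lookup P-length b∈) ⟩
          length b                                          ≡⟨ count-not (λ v → mem v (concat Qs)) b ⟩
          count (λ v → mem v (concat Qs)) b + count unused b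
            ≤⟨ +-monoˡ-≤ _ (avoids⇒few Qs (unique-concat⇒disjoint P P-unique) b∈ (transitive⇒unique (All.lookup P-transitive b∈)) |Q| avoidsQ) ⟩
          k + count unused b                                ≡⟨ cong (k +_) (sym (length-filterᵇ unused b)) ⟩
          k + length (prune b) ∎)
          where open ≤-Reasoning

        prune-⊆ : ∀ b → prune b ⊆ b
        prune-⊆ b v∈ = proj₁ (∈-filterᵇ⁻ unused {xs = b} v∈)

        prunes : ∀ bs → Pointwise _⊆_ (map prune bs) bs
        prunes []       = []
        prunes (b ∷ bs) = prune-⊆ b ∷ prunes bs

        blobs : All (Blob k) (map prune P ++ Qs)
        blobs = All.++⁺ (All.map⁺ (All.tabulate prune-blob))
          (All.zipWith (λ { (tr , l) → tr , ≤-reflexive (sym l) }) (trQ , |Q|))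

        -- Domination passes to sublists, so both occurrences of `S₀`, at the start of the chain and
        -- at the end of the return, can be pruned alike.
        closed : Linked _⇛_ (prune S₀ ∷ (map prune bs ++ Qs) ++ [ prune S₀ ])
        closed = subst (λ l → Linked _⇛_ (prune S₀ ∷ l)) (sym (++-assoc (map prune bs) Qs [ prune S₀ ]))
          (linked-shrink (prune-⊆ S₀ ∷ Pointwise.++⁺ (prunes bs) (Pointwise.++⁺ (Pointwise.refl (λ {_} {_} x∈ → x∈)) (prune-⊆ S₀ ∷ [])))
            (walk-linked walk linked))

        concat≡ : concat (map prune P ++ Qs) ≡ filterᵇ unused (concat P) ++ concat Qs
        concat≡ = trans (sym (concat-++ (map prune P) Qs)) (cong (_++ concat Qs) (concat-filter unused P))

        distinct : Unique (concat (map prune P ++ Qs))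
        distinct = subst Unique (sym concat≡) (Unique.++⁺ (Unique.filter⁺ (T? ∘ unused) P-unique)
          (avoids⇒unique Qs trQ avoidsQ)
          λ { (v∈P , v∈Qs) → not-mem⇒∉ (proj₂ (∈-filterᵇ⁻ unused {xs = concat P} v∈P)) v∈Qs })

        cycle : IsCyclePower 𝒯 k (length (concat (map prune P ++ Qs))) (lookup (concat (map prune P ++ Qs)))
        cycle = closed-walk⇒cyclePower (prune S₀) (map prune bs ++ Qs) blobs closed distinct

        long : suc t * k ≤ length (concat (map prune P ++ Qs))
        long = begin
          suc t * k                                ≡⟨ cong (λ l → suc l * k) (sym |bs|) ⟩
          length P * k                             ≡⟨ cong (_* k) (sym (length-map prune P)) ⟩
          length (map prune P) * k
            ≤⟨ length-concat≥ k (map prune P) (All.map⁺ (All.tabulate λ b∈ → proj₂ (prune-blob b∈))) ⟩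
          length (concat (map prune P))            ≤⟨ m≤m+n _ (length (concat Qs)) ⟩
          length (concat (map prune P)) + length (concat Qs) ≡⟨ sym (length-++ (concat (map prune P))) ⟩
          length (concat (map prune P) ++ concat Qs) ≡⟨ cong length (concat-++ (map prune P) Qs) ⟩
          length (concat (map prune P ++ Qs)) ∎
          where open ≤-Reasoning

    CyclePower : Set
    CyclePower = ∃ λ m → n ≤ 1000 * E * m × ∃ λ (x : Fin m → V) → IsCyclePower 𝒯 k m x

    cyclePower : CyclePower
    cyclePower = begin-with 𝒮.startBlob blobNumber
      where
      begin-with : (∃ λ S → length S ≡ 2 * k × Transitive S × n ≤ G ^ 2 * count (𝒮.Sources S) U × n ≤ G ^ 2 * count (𝒮.Sinks S) K) →
        (∃ λ t → N * suc t ≤ n × n ≤ 2 * (N * suc t)) → CyclePower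
      begin-with (S₀ , |S₀| , tr₀ , sources , sinks) (t , t-small , n≤) =
        close (truncate (𝒮.Sources S₀) (G ^ 11) U-unique sources-large)
        where
        open ≤-Reasoning
        path-small : 4 * E * (length S₀ + t * (2 * k)) ≤ n
        path-small = ≤-trans (≤-reflexive (trans (cong (λ l → 4 * E * (l + t * (2 * k))) |S₀|) (eq E k t))) t-small
          where
          eq : ∀ e k t → 4 * e * (2 * k + t * (2 * k)) ≡ 8 * e * k * suc t
          eq = solve-∀
        S₀⟶sinks : ∀ {x v} → x ∈ S₀ → 𝒮.Sinks S₀ v ≡ true → x ⟶ v
        S₀⟶sinks {v = v} x∈ h = all-elim (λ a → arc 𝒯 a v) S₀ h x∈
        path : ℒ.PathFrom S₀ S₀ t
        path = ℒ.longPath t S₀ S₀ (𝒮.Sinks S₀) path-small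
          (≤-trans sinks (*-monoʳ-≤ (G ^ 2) (count-mono K λ _ h →
            ∧-intro (∉⇒not-mem (λ v∈ → ⟶⇒≢ (S₀⟶sinks v∈ h) refl)) h)))
          S₀⟶sinks
        sources-large : G ^ 11 ≤ count (𝒮.Sources S₀) U
        sources-large = *-cancelˡ-≤ (G ^ 2) {{m^n≢0 G 2}} (begin
          G ^ 2 * G ^ 11                      ≡⟨ sym (^-distribˡ-+-* G 2 11) ⟩
          G ^ 13                              ≤⟨ G^-mono {13} {20} (m≤m+n 13 7) ⟩
          G ^ 20                              ≤⟨ G^20≤n ⟩
          n                                   ≤⟨ sources ⟩
          G ^ 2 * count (𝒮.Sources S₀) U ∎)
        half : 2 * G ^ 11 ≤ length U
        half = begin
          2 * G ^ 11      ≤⟨ *-monoˡ-≤ (G ^ 11) (≤-trans (m≤m+n 2 14) G≥16) ⟩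
          G ^ 12          ≤⟨ G^-mono {12} {19} (m≤m+n 12 7) ⟩
          G ^ 19          ≤⟨ 𝒮.K-large ⟩
          length K        ≤⟨ 𝒮.|K|≤|U| ⟩
          length U ∎
        open Closing t S₀ |S₀| tr₀ path using (P; P-length; module Pruned)
        open ℒ.PathFrom path using (end; X; end⟶X; X-large)
        close : (∃ λ Y → (∀ {v} → Y v ≡ true → 𝒮.Sources S₀ v ≡ true) × count Y U ≡ G ^ 11) → CyclePower
        close (Y , Y⊆ , |Y|) = finish (connect (≤-reflexive (sym |Y|)) (≤-trans (≤-reflexive (cong (2 *_) |Y|)) half)
            (≤-trans 𝒮.n≤G|K| (*-monoʳ-≤ G 𝒮.|K|≤|U|)) X end
            (≤-trans X-large (*-monoʳ-≤ (G ^ 2) (count-⊆ X K-unique K⊆U))) end⟶X)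
          where
          open Connecting 𝒯 k D E G 4≤E 4E≤G (≤-trans 2E≤4E 4E≤D) k≤G 2^k≤G G^20≤n choose-k P P-length
            S₀ Y (λ {v} h x∈ → all-elim (arc 𝒯 v) S₀ (Y⊆ h) x∈) U U-unique U-dense
          finish : Connectors [] end → CyclePower
          finish (Qs , linked , trQ , |Q| , avoidsQ) = _ , (begin
              n                        ≤⟨ n≤ ⟩
              2 * (8 * E * k * suc t)  ≡⟨ eq E k t ⟩
              -- Each of the `suc t` chain blobs keeps at least `k` vertices, so the argument itself
              -- yields length n/16E; the passage to 1000 is slack.
              16 * E * (suc t * k)     ≤⟨ *-mono-≤ (*-monoˡ-≤ E (m≤m+n 16 984)) long ⟩
              1000 * E * _ ∎) , _ , cycle
            where
            open Pruned Qs linked trQ |Q| avoidsQ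
            eq : ∀ e k t → 2 * (8 * e * k * suc t) ≡ 16 * e * (suc t * k)
            eq = solve-∀

  -- List orders as permutations

  sum-allFin-suc : ∀ m (f : Fin (suc m) → ℕ) → sumOf (allFin (suc m)) f ≡ f zero + sumOf (allFin m) (f ∘ suc)
  sum-allFin-suc m f = cong (f zero +_) (trans (cong (λ l → sumOf l f) (sym (map-tabulate (λ i → i) suc))) (sum-map suc (allFin m) f))

  sum-lookup : ∀ {A : Set} (xs : List A) f → sumOf (allFin (length xs)) (f ∘ lookup xs) ≡ sumOf xs f
  sum-lookup []       f = refl
  sum-lookup (x ∷ xs) f = trans (sum-allFin-suc (length xs) _) (cong (f x +_) (sum-lookup xs f))

  sum-cast : ∀ {m l} (eq : m ≡ l) (f : Fin l → ℕ) → sumOf (allFin m) (f ∘ cast eq) ≡ sumOf (allFin l) f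
  sum-cast {m} refl f = sum-cong (allFin m) λ i → cong f (cast-is-id refl i)

  length-filter-≟ : ∀ {A : Set} (f g : A → Bool) xs → (∀ x → f x ≡ g x) →
    length (filter (λ x → f x Bool.≟ true) xs) ≡ count g xs
  length-filter-≟ f g []       h = refl
  length-filter-≟ f g (x ∷ xs) h with f x | g x | h x
  ... | true  | true  | refl = cong suc (length-filter-≟ f g xs h)
  ... | false | false | refl = length-filter-≟ f g xs h

  module OrderPermutation {n : ℕ} (𝒯 : Tournament n) where
    open TournamentLists 𝒯
    open Orders 𝒯

    backward : ∀ {m} → (Fin m → V) → Fin m → Fin m → Bool
    backward f i j = (toℕ i <ᵇ toℕ j) ∧ arc 𝒯 (f j) (f i)

    sum-backward : ∀ xs → sumOf (allFin (length xs)) (λ i → count (backward (lookup xs) i) (allFin (length xs))) ≡ back xs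
    sum-backward []       = refl
    sum-backward (x ∷ xs) = trans (sum-allFin-suc m _) (cong₂ _+_
      (trans (sum-allFin-suc m (𝟙 ∘ backward (lookup (x ∷ xs)) zero)) (sum-lookup xs (λ y → 𝟙 (arc 𝒯 y x))))
      (trans (sum-cong (allFin m) λ i → sum-allFin-suc m (𝟙 ∘ backward (lookup (x ∷ xs)) (suc i))) (sum-backward xs)))
      where
      m : ℕ
      m = length xs

    -- The local predicate of backwardCount cannot be named, so it is recovered by unification.
    isBackward : Permutation′ n → V × V → Bool
    isBackward σ = predicate (refl {x = backwardCount 𝒯 σ})
      where
      predicate : ∀ {f : V × V → Bool} →
        length (filter (λ x → f x Bool.≟ true) (cartesianProduct (allFin n) (allFin n))) ≡ backwardCount 𝒯 σ → V × V → Bool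
      predicate {f} _ = f

    isBackward≡ : ∀ σ p → isBackward σ p ≡ backward (σ ⟨$⟩ʳ_) (proj₁ p) (proj₂ p)
    isBackward≡ σ (i , j) with toℕ i <? toℕ j
    ... | yes i<j = cong (_∧ arc 𝒯 (σ ⟨$⟩ʳ j) (σ ⟨$⟩ʳ i)) (sym (dec-true (toℕ i <? toℕ j) i<j))
    ... | no  i≮j = cong (_∧ arc 𝒯 (σ ⟨$⟩ʳ j) (σ ⟨$⟩ʳ i)) (sym (dec-false (toℕ i <? toℕ j) i≮j))

    backwardCount≡ : ∀ σ → backwardCount 𝒯 σ ≡ sumOf (allFin n) (λ i → count (backward (σ ⟨$⟩ʳ_) i) (allFin n))
    backwardCount≡ σ = trans
      (length-filter-≟ (isBackward σ) (λ p → backward (σ ⟨$⟩ʳ_) (proj₁ p) (proj₂ p)) (cartesianProduct (allFin n) (allFin n)) (isBackward≡ σ))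
      (sum-cartesianProduct (allFin n) (allFin n) _)

    -- Intransitivity speaks of permutations, while the core argument builds lists. The permutation
    -- sends i to the i-th entry of `π`, and its inverse reads off the index of a vertex in `π`.
    orderPermutation : ∀ {π} → π ↭ allFin n → ∃ λ σ → backwardCount 𝒯 σ ≡ back π
    orderPermutation {π} π↭ = σ , (begin
      backwardCount 𝒯 σ                                                          ≡⟨ backwardCount≡ σ ⟩
      sumOf (allFin n) (λ i → count (backward f i) (allFin n))
        ≡⟨ sum-cong (allFin n) (λ i → trans (count-cong (allFin n) (backward-cast i)) (sum-cast n≡l _)) ⟩
      sumOf (allFin n) (λ i → count (backward (lookup π) (cast n≡l i)) (allFin (length π)))
        ≡⟨ sum-cast n≡l (λ i → count (backward (lookup π) i) (allFin (length π))) ⟩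
      sumOf (allFin (length π)) (λ i → count (backward (lookup π) i) (allFin (length π)))   ≡⟨ sum-backward π ⟩
      back π ∎)
      where
      open ≡-Reasoning
      l≡n : length π ≡ n
      l≡n = trans (Perm.↭-length π↭) (length-tabulate (λ (i : V) → i))
      n≡l : n ≡ length π
      n≡l = sym l≡n
      π-unique : Unique π
      π-unique = unique-resp-↭ (↭-sym π↭) (Unique.allFin⁺ n)
      ∈π : ∀ v → v ∈ π
      ∈π v = Perm.∈-resp-↭ (↭-sym π↭) (∈-allFin v)
      f g : V → V
      f i = lookup π (cast n≡l i)
      g v = cast l≡n (Any.index (∈π v))
      f∘g : ∀ v → f (g v) ≡ v
      f∘g v = trans (cong (lookup π) (trans (cast-trans l≡n n≡l _) (cast-is-id refl _))) (sym (lookup-index (∈π v)))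
      g∘f : ∀ i → g (f i) ≡ i
      g∘f i = trans (cong (cast l≡n) (lookup-injective π-unique (sym (lookup-index (∈π (f i))))))
        (trans (cast-trans n≡l l≡n i) (cast-is-id refl i))
      σ : Permutation′ n
      σ = permutation f g f∘g g∘f
      backward-cast : ∀ i j → backward f i j ≡ backward (lookup π) (cast n≡l i) (cast n≡l j)
      backward-cast i j = cong₂ (λ a b → (a <ᵇ b) ∧ arc 𝒯 (f j) (f i)) (sym (toℕ-cast n≡l i)) (sym (toℕ-cast n≡l j))

  -- The choice of constants

  n<2^n : ∀ n → n < 2 ^ n
  n<2^n zero    = s≤s z≤n
  n<2^n (suc n) = begin-strict
    suc n          <⟨ +-mono-≤-< (m^n>0 2 n) (n<2^n n) ⟩
    2 ^ n + 2 ^ n  ≡⟨ cong (2 ^ n +_) (sym (+-identityʳ (2 ^ n))) ⟩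
    2 ^ suc n ∎
    where open ≤-Reasoning

  module Natural {n : ℕ} (𝒯 : Tournament n) (k E : ℕ) (1≤k : 1 ≤ k) (4≤E : 4 ≤ E) (large : (E ^ (24 * k)) ^ 20 ≤ n)
    (intransitive : ∀ {π} → π ↭ allFin n → n * n ≤ E * Orders.back 𝒯 π) where

    open TournamentLists 𝒯
    open Orders 𝒯

    -- `D` has to dominate 4E for the chain and 2E² for the starting blob, and E³ does both. `G` has
    -- to dominate `D ^ (2 * s + 4)` up to s = 2k, which is E to the power 12k + 12 ≤ 24k.
    D G : ℕ
    D = E ^ 3
    G = E ^ (24 * k)

    instance
      E≢0 : NonZero E
      E≢0 = >-nonZero (≤-trans (m≤m+n 1 3) 4≤E)

    E^≤G : ∀ {a} → a ≤ 24 * k → E ^ a ≤ G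
    E^≤G = ^-monoʳ-≤ E

    4E≤E² : 4 * E ≤ E ^ 2
    4E≤E² = ≤-trans (*-monoˡ-≤ E 4≤E) (≤-reflexive (cong (E *_) (sym (*-identityʳ E))))

    24≤24k : 24 ≤ 24 * k
    24≤24k = *-monoʳ-≤ 24 1≤k

    4E≤G : 4 * E ≤ G
    4E≤G = ≤-trans 4E≤E² (E^≤G (≤-trans (m≤m+n 2 22) 24≤24k))

    4E≤D : 4 * E ≤ D
    4E≤D = ≤-trans 4E≤E² (^-monoʳ-≤ E (m≤m+n 2 1))

    4≤D : 4 ≤ D
    4≤D = ≤-trans (m≤m*n 4 E) 4E≤D

    2EE≤D : 2 * E * E ≤ D
    2EE≤D = begin
      2 * E * E     ≡⟨ eq E ⟩
      2 * E ^ 2     ≤⟨ *-monoˡ-≤ (E ^ 2) (≤-trans (m≤m+n 2 2) 4≤E) ⟩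
      E ^ 3 ∎
      where
      open ≤-Reasoning
      eq : ∀ e → 2 * e * e ≡ 2 * (e * (e * 1))
      eq = solve-∀

    2^k≤G : 2 ^ k ≤ G
    2^k≤G = ≤-trans (^-monoˡ-≤ k (≤-trans (m≤m+n 2 2) 4≤E)) (E^≤G (m≤n*m k 24))

    choose-s : ∀ {s} → 1 ≤ s → s ≤ 2 * k → Choosable D G s
    choose-s {s} 1≤s s≤2k r A B B≥1 uA A-large degree =
      let S , |S| , tr , S⊆A , many = dependentRandomChoice {D = D} {s = s} 4≤D 1≤s r A B B≥1 uA
            (≤-trans (D^≤G (+-monoʳ-≤ (2 * s) (m≤m+n 1 3))) A-large) degree
      in S , |S| , tr , S⊆A , ≤-trans many (*-monoˡ-≤ (count (common r S) B) (D^≤G ≤-refl))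
      where
      open ≤-Reasoning
      D^≤G : ∀ {a} → a ≤ 2 * s + 4 → D ^ a ≤ G
      D^≤G {a} a≤ = begin
        D ^ a           ≡⟨ ^-*-assoc E 3 a ⟩
        E ^ (3 * a)     ≤⟨ E^≤G exponent ⟩
        G ∎
        where
        eq₁ : ∀ k → 3 * (2 * (2 * k) + 4) ≡ 12 * k + 12
        eq₁ = solve-∀
        eq₂ : ∀ k → 12 * k + 12 * k ≡ 24 * k
        eq₂ = solve-∀
        exponent : 3 * a ≤ 24 * k
        exponent = begin
          3 * a                       ≤⟨ *-monoʳ-≤ 3 (≤-trans a≤ (+-monoˡ-≤ 4 (*-monoʳ-≤ 2 s≤2k))) ⟩
          3 * (2 * (2 * k) + 4)       ≡⟨ eq₁ k ⟩
          12 * k + 12                 ≤⟨ +-monoʳ-≤ (12 * k) (*-monoʳ-≤ 12 1≤k) ⟩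
          12 * k + 12 * k             ≡⟨ eq₂ k ⟩
          24 * k ∎

    1≤n : 1 ≤ n
    1≤n = ≤-trans (m^n>0 G {{m^n≢0 E (24 * k)}} 20) large

    core : Core E
    core = fromOrder (core-or-order E n (allFin n) (≤-reflexive |allFin|) (Unique.allFin⁺ n) (≤-trans 1≤n (≤-reflexive (sym |allFin|))))
      where
      |allFin| : length (allFin n) ≡ n
      |allFin| = length-tabulate (λ (i : Fin n) → i)
      fromOrder : Core E ⊎ NearlyTransitive E (allFin n) → Core E
      fromOrder (inj₁ c) = c
      -- For the full vertex set the strict bound reads 2E · back < 2n², whereas intransitivity
      -- gives n² ≤ E · back.
      fromOrder (inj₂ (π , π↭ , few)) = contradiction (begin
        n * length (allFin n) + length (allFin n) * length (allFin n) ≡⟨ cong (λ l → n * l + l * l) |allFin| ⟩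
        n * n + n * n           ≡⟨ cong (n * n +_) (sym (+-identityʳ (n * n))) ⟩
        2 * (n * n)             ≤⟨ *-monoʳ-≤ 2 (intransitive π↭) ⟩
        2 * (E * back π)        ≡⟨ sym (*-assoc 2 E (back π)) ⟩
        2 * E * back π ∎) (<⇒≱ few)
        where open ≤-Reasoning

    open Assembly 𝒯 k D E G 4≤E 1≤k 4E≤G 4E≤D 2EE≤D (≤-trans (<⇒≤ (n<2^n k)) 2^k≤G) 2^k≤G large
      (choose-s 1≤k (m≤m+n k (k + 0))) (choose-s (≤-trans 1≤k (m≤m+n k (k + 0))) ≤-refl) core public
      using (cyclePower; CyclePower)

  -- Passing between rational and natural bounds

  ℕtoℚ≡ : ∀ n → ℕtoℚ n ≡ mkℚ (ℤ.+ n) 0 (Coprimality.sym (1-coprimeTo n))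
  ℕtoℚ≡ n = ℚ.↥p/↧p≡p (mkℚ (ℤ.+ n) 0 (Coprimality.sym (1-coprimeTo n)))

  toℚᵘ-ℕtoℚ : ∀ n → toℚᵘ (ℕtoℚ n) ℚᵘ.≃ mkℚᵘ (ℤ.+ n) 0
  toℚᵘ-ℕtoℚ n = ℚᵘ.≃-reflexive (cong toℚᵘ (ℕtoℚ≡ n))

  ℕtoℚ-cancel-≤ : ∀ {a b} → ℕtoℚ a ℚ.≤ ℕtoℚ b → a ≤ b
  ℕtoℚ-cancel-≤ {a} {b} le = ℤ.drop‿+≤+ (subst₂ ℤ._≤_ (ℤ.*-identityʳ (ℤ.+ a)) (ℤ.*-identityʳ (ℤ.+ b))
    (ℚ.drop-*≤* (subst₂ ℚ._≤_ (ℕtoℚ≡ a) (ℕtoℚ≡ b) le)))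

  ℕtoℚ-* : ∀ a b → ℕtoℚ a ℚ.* ℕtoℚ b ≡ ℕtoℚ (a * b)
  ℕtoℚ-* a b = trans (cong₂ ℚ._*_ (ℕtoℚ≡ a) (ℕtoℚ≡ b)) (cong (ℚ._/ 1) (sym (ℤ.pos-* a b)))

  ℕtoℚ-nonNeg : ∀ a → ℚ.NonNegative (ℕtoℚ a)
  ℕtoℚ-nonNeg a = subst ℚ.NonNegative (sym (ℕtoℚ≡ a)) _

  ℕtoℚ-^ : ∀ {e r} → ℕtoℚ e ℚ.≤ r → ∀ c → ℕtoℚ (e ^ c) ℚ.≤ r ^ℚ c
  ℕtoℚ-^ {e} {r} e≤r zero    = ℚ.≤-refl
  ℕtoℚ-^ {e} {r} e≤r (suc c) = begin
    ℕtoℚ (e * e ^ c)          ≡⟨ sym (ℕtoℚ-* e (e ^ c)) ⟩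
    ℕtoℚ e ℚ.* ℕtoℚ (e ^ c)   ≤⟨ ℚ.*-monoʳ-≤-nonNeg (ℕtoℚ (e ^ c)) {{ℕtoℚ-nonNeg (e ^ c)}} e≤r ⟩
    r ℚ.* ℕtoℚ (e ^ c)        ≤⟨ ℚ.*-monoˡ-≤-nonNeg r {{r≥0}} (ℕtoℚ-^ e≤r c) ⟩
    r ℚ.* (r ^ℚ c) ∎
    where
    open ℚ.≤-Reasoning
    r≥0 : ℚ.NonNegative r
    r≥0 = ℚ.nonNegative (ℚ.≤-trans (ℚ.nonNegative⁻¹ (ℕtoℚ e) {{ℕtoℚ-nonNeg e}}) e≤r)

  module RationalBounds (p-1 d-1 : ℕ) .(coprime : Coprime (suc p-1) (suc d-1)) where

    p q : ℕ
    p = suc p-1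
    q = suc d-1

    ε : ℚ
    ε = mkℚ ℤ.+[1+ p-1 ] d-1 coprime

    ε<¼⇒4p<q : ε ℚ.< (ℤ.+ 1) ℚ./ 4 → 4 * p < q
    ε<¼⇒4p<q (*<* lt) = subst₂ _<_ (*-comm p 4) (+-identityʳ q) (ℤ.drop‿+<+ lt)

    -- The reciprocal of a positive fraction in constructor form computes to the fraction with
    -- numerator and denominator exchanged, so powers of 1/ε can be handled in this form.
    e≤1/ε : ∀ {e} → e * p ≤ q → ℕtoℚ e ℚ.≤ mkℚ ℤ.+[1+ d-1 ] p-1 (Coprimality.sym coprime)
    e≤1/ε {e} e*p≤q = subst (ℚ._≤ _) (sym (ℕtoℚ≡ e)) (*≤* (subst₂ ℤ._≤_ (ℤ.pos-* e p) (cong ℤ.+_ (sym (*-identityʳ q))) (ℤ.+≤+ e*p≤q)))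

    intransitive⇒ : ∀ {n b} → ε ℚ.* (ℕtoℚ n ℚ.* ℕtoℚ n) ℚ.≤ ℕtoℚ b → p * (n * n) ≤ q * b
    intransitive⇒ {n} {b} le = subst₂ _≤_ (*-identityʳ _) (eq b q) (ℤ.drop‿+≤+ (subst₂ ℤ._≤_ lhs rhs (ℚᵘ.drop-*≤* leᵘ)))
      where
      open ℚᵘ.≤-Reasoning
      leᵘ : mkℚᵘ ℤ.+[1+ p-1 ] d-1 ℚᵘ.* mkℚᵘ (ℤ.+ (n * n)) 0 ℚᵘ.≤ mkℚᵘ (ℤ.+ b) 0
      leᵘ = begin
        toℚᵘ ε ℚᵘ.* mkℚᵘ (ℤ.+ (n * n)) 0       ≃⟨ ℚᵘ.*-congˡ {toℚᵘ ε} (ℚᵘ.≃-sym (toℚᵘ-ℕtoℚ (n * n))) ⟩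
        toℚᵘ ε ℚᵘ.* toℚᵘ (ℕtoℚ (n * n))        ≃⟨ ℚᵘ.≃-sym (ℚ.toℚᵘ-homo-* ε (ℕtoℚ (n * n))) ⟩
        toℚᵘ (ε ℚ.* ℕtoℚ (n * n))              ≤⟨ ℚ.toℚᵘ-mono-≤ (subst (λ z → ε ℚ.* z ℚ.≤ ℕtoℚ b) (ℕtoℚ-* n n) le) ⟩
        toℚᵘ (ℕtoℚ b)                          ≃⟨ toℚᵘ-ℕtoℚ b ⟩
        mkℚᵘ (ℤ.+ b) 0 ∎
      lhs : (ℤ.+ p ℤ.* ℤ.+ (n * n)) ℤ.* ℤ.+ 1 ≡ ℤ.+ (p * (n * n) * 1)
      lhs = trans (cong (ℤ._* ℤ.+ 1) (sym (ℤ.pos-* p (n * n)))) (sym (ℤ.pos-* (p * (n * n)) 1))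
      rhs : ℤ.+ b ℤ.* ℤ.+ (q * 1) ≡ ℤ.+ (b * (q * 1))
      rhs = sym (ℤ.pos-* b (q * 1))
      eq : ∀ b q → b * (q * 1) ≡ q * b
      eq = solve-∀

    length⇐ : ∀ {n m} → p * n ≤ 1500 * q * m → (ε ℚ.* ℕtoℚ n) ℚ.* ((ℤ.+ 1) ℚ./ 1500) ℚ.≤ ℕtoℚ m
    length⇐ {n} {m} le = ℚ.toℚᵘ-cancel-≤ (begin
      toℚᵘ ((ε ℚ.* ℕtoℚ n) ℚ.* c)                              ≃⟨ ℚ.toℚᵘ-homo-* (ε ℚ.* ℕtoℚ n) c ⟩
      toℚᵘ (ε ℚ.* ℕtoℚ n) ℚᵘ.* toℚᵘ c                          ≃⟨ ℚᵘ.*-congʳ {toℚᵘ c} (ℚ.toℚᵘ-homo-* ε (ℕtoℚ n)) ⟩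
      (toℚᵘ ε ℚᵘ.* toℚᵘ (ℕtoℚ n)) ℚᵘ.* toℚᵘ c
        ≃⟨ ℚᵘ.*-congʳ {toℚᵘ c} (ℚᵘ.*-congˡ {toℚᵘ ε} (toℚᵘ-ℕtoℚ n)) ⟩
      (mkℚᵘ ℤ.+[1+ p-1 ] d-1 ℚᵘ.* mkℚᵘ (ℤ.+ n) 0) ℚᵘ.* mkℚᵘ (ℤ.+ 1) 1499 ≤⟨ ℚᵘ.*≤* inℤ ⟩
      mkℚᵘ (ℤ.+ m) 0                                           ≃⟨ ℚᵘ.≃-sym (toℚᵘ-ℕtoℚ m) ⟩
      toℚᵘ (ℕtoℚ m) ∎)
      where
      open ℚᵘ.≤-Reasoning
      c : ℚ
      c = (ℤ.+ 1) ℚ./ 1500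
      inℤ : ((ℤ.+ p ℤ.* ℤ.+ n) ℤ.* ℤ.+ 1) ℤ.* ℤ.+ 1 ℤ.≤ ℤ.+ m ℤ.* ℤ.+ (q * 1 * 1500)
      inℤ = subst₂ ℤ._≤_ (trans (ℤ.pos-* p n) (sym (trans (ℤ.*-identityʳ _) (ℤ.*-identityʳ _)))) (ℤ.pos-* m (q * 1 * 1500))
        (ℤ.+≤+ (≤-trans le (≤-reflexive (trans (cong (λ z → 1500 * z * m) (sym (*-identityʳ q))) (trans (*-comm (1500 * (q * 1)) m) (cong (m *_) (*-comm 1500 (q * 1))))))))

  module PositiveFraction (p-1 d-1 : ℕ) .(coprime : Coprime (suc p-1) (suc d-1)) where
    open RationalBounds p-1 d-1 coprime

    e E : ℕ
    e = q / p
    E = suc e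

    e*p≤q : e * p ≤ q
    e*p≤q = m/n*n≤m q p

    q≤E*p : q ≤ E * p
    q≤E*p = ≤-trans (≤-reflexive (m≡m%n+[m/n]*n q p)) (+-monoˡ-≤ (e * p) (<⇒≤ (m%n<n q p)))

    4≤e : 4 * p < q → 4 ≤ e
    4≤e lt = ≤-trans (≤-reflexive (sym (m*n/n≡m 4 p))) (/-monoˡ-≤ p (<⇒≤ lt))

    -- The hypothesis on `n` bounds powers of `e`, the rounded-down value of 1/ε, while the argument
    -- needs powers of `E = suc e`. As E ≤ e², doubling the exponent bridges the gap.
    E-power≤ : ∀ {c a n} → 4 ≤ e → 2 * a ≤ c →
      mkℚ ℤ.+[1+ d-1 ] p-1 (Coprimality.sym coprime) ^ℚ c ℚ.≤ ℕtoℚ n → E ^ a ≤ n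
    E-power≤ {c} {a} {n} 4≤e 2a≤c large = begin
      E ^ a          ≤⟨ ^-monoˡ-≤ a E≤e² ⟩
      (e ^ 2) ^ a    ≡⟨ ^-*-assoc e 2 a ⟩
      e ^ (2 * a)    ≤⟨ ^-monoʳ-≤ e {{>-nonZero 1≤e}} 2a≤c ⟩
      e ^ c          ≤⟨ ℕtoℚ-cancel-≤ {e ^ c} {n} (ℚ.≤-trans (ℕtoℚ-^ {e} (e≤1/ε {e} e*p≤q) c) large) ⟩
      n ∎
      where
      open ≤-Reasoning
      1≤e : 1 ≤ e
      1≤e = ≤-trans (m≤m+n 1 3) 4≤e
      E≤e² : E ≤ e ^ 2
      E≤e² = begin
        1 + e      ≤⟨ +-monoˡ-≤ e 1≤e ⟩
        e + e      ≡⟨ cong (e +_) (sym (+-identityʳ e)) ⟩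
        2 * e      ≤⟨ *-monoˡ-≤ e (≤-trans (m≤m+n 2 2) 4≤e) ⟩
        e * e      ≡⟨ cong (e *_) (sym (*-identityʳ e)) ⟩
        e ^ 2 ∎

    -- Since p < q/4 and ep ≤ q, the product Ep is at most 5q/4, which turns 1000 into 1250.
    length-bound : ∀ {n m} → 4 * p < q → n ≤ 1000 * E * m → p * n ≤ 1500 * q * m
    length-bound {n} {m} lt n≤ = begin
      p * n                            ≤⟨ *-monoʳ-≤ p n≤ ⟩
      p * (1000 * E * m)               ≡⟨ eq₁ p e m ⟩
      (250 * (4 * p) + 1000 * (e * p)) * m
        ≤⟨ *-monoˡ-≤ m (+-mono-≤ (*-monoʳ-≤ 250 (<⇒≤ lt)) (*-monoʳ-≤ 1000 e*p≤q)) ⟩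
      (250 * q + 1000 * q) * m         ≡⟨ cong (_* m) (sym (*-distribʳ-+ q 250 1000)) ⟩
      1250 * q * m                     ≤⟨ *-monoˡ-≤ m (*-monoˡ-≤ q (m≤m+n 1250 250)) ⟩
      1500 * q * m ∎
      where
      open ≤-Reasoning
      eq₁ : ∀ p e m → p * (1000 * suc e * m) ≡ (250 * (4 * p) + 1000 * (e * p)) * m
      eq₁ = solve-∀

    -- The constant 1500 absorbs the rounding: 1/E < ε < (5/4)/E for E = ⌊1/ε⌋ + 1.
    longCyclePower : ∀ {k n} → 1 ≤ k → ε ℚ.< (ℤ.+ 1) ℚ./ 4 →
      mkℚ ℤ.+[1+ d-1 ] p-1 (Coprimality.sym coprime) ^ℚ (100000 * k) ℚ.≤ ℕtoℚ n →
      (𝒯 : Tournament n) → Intransitive ε 𝒯 →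
      ∃ λ m → (ε ℚ.* ℕtoℚ n) ℚ.* ((ℤ.+ 1) ℚ./ 1500) ℚ.≤ ℕtoℚ m × ∃ λ (x : Fin m → Fin n) → IsCyclePower 𝒯 k m x
    longCyclePower {k} {n} 1≤k ε<¼ large 𝒯 intransitive = finish cyclePower
      where
      open ≤-Reasoning
      4p<q : 4 * p < q
      4p<q = ε<¼⇒4p<q ε<¼
      exponent : 2 * (24 * k * 20) ≤ 100000 * k
      exponent = ≤-trans (≤-reflexive (eq k)) (*-monoˡ-≤ k (≤ᵇ⇒≤ 960 100000 tt))
        where
        eq : ∀ k → 2 * (24 * k * 20) ≡ 960 * k
        eq = solve-∀
      n≥ : (E ^ (24 * k)) ^ 20 ≤ n
      n≥ = ≤-trans (≤-reflexive (^-*-assoc E (24 * k) 20)) (E-power≤ {100000 * k} {24 * k * 20} (4≤e 4p<q) exponent large)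
      backward≥ : ∀ {π} → π ↭ allFin n → n * n ≤ E * Orders.back 𝒯 π
      backward≥ {π} π↭ = let σ , σ≡ = OrderPermutation.orderPermutation 𝒯 π↭ in *-cancelˡ-≤ p (begin
        p * (n * n)                          ≤⟨ intransitive⇒ {n} {backwardCount 𝒯 σ} (intransitive σ) ⟩
        q * backwardCount 𝒯 σ                ≡⟨ cong (q *_) σ≡ ⟩
        q * Orders.back 𝒯 π                  ≤⟨ *-monoˡ-≤ _ q≤E*p ⟩
        E * p * Orders.back 𝒯 π              ≡⟨ eq E p (Orders.back 𝒯 π) ⟩
        p * (E * Orders.back 𝒯 π) ∎)
        where
        eq : ∀ e p b → e * p * b ≡ p * (e * b)
        eq = solve-∀
      open Natural 𝒯 k E 1≤k (m≤n⇒m≤1+n (4≤e 4p<q)) n≥ backward≥ using (cyclePower; CyclePower)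
      finish : CyclePower →
        ∃ λ m → (ε ℚ.* ℕtoℚ n) ℚ.* ((ℤ.+ 1) ℚ./ 1500) ℚ.≤ ℕtoℚ m × ∃ λ (x : Fin m → Fin n) → IsCyclePower 𝒯 k m x
      finish (m , n≤ , x , cycle) = m , length⇐ {n} {m} (length-bound {n} {m} 4p<q n≤) , x , cycle

open import Defs
open import Data.Nat as ℕ using (ℕ)
open import Data.Fin using (Fin)
open import Data.Product using (∃; _×_)
open import Data.Rational as ℚ using (ℚ; 0ℚ; mkℚ; *<*; _/_; _*_; _≤_; _<_)
open import Data.Integer as ℤ using (+_; +[1+_]; -[1+_])

theorem1p3 : (k : ℕ) → 1 ℕ.≤ k → (ε : ℚ) → (ε>0 : 0ℚ < ε) → ε < (+ 1) / 4 →
    (n : ℕ) → invPow ε ε>0 (100000 ℕ.* k) ≤ ℕtoℚ n →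
    (T : Tournament n) → Intransitive ε T →
    ∃ λ (m : ℕ) → (ε * ℕtoℚ n) * ((+ 1) / 1500) ≤ ℕtoℚ m ×
    ∃ λ (x : Fin m → Fin n) → IsCyclePower T k m x
theorem1p3 k 1≤k (mkℚ ℤ.+0 _ _) (*<* (ℤ.+<+ ()))
theorem1p3 k 1≤k (mkℚ +[1+ p-1 ] d-1 coprime) ε>0 ε<¼ n large T intransitive =
  CyclePowers.PositiveFraction.longCyclePower p-1 d-1 coprime 1≤k ε<¼ large T intransitive
theorem1p3 k 1≤k (mkℚ -[1+ _ ] _ _) (*<* ())
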